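{- Under the standing setup below (in either the constant or the nonconstant case), if $n\le\frac{t-1}{2}$ and $q>(6n d_1)^{\frac{2t+2}{t-2n}}$, then the system $\sum_{i=1}^t a_{ji}X_i^{d_i}=g_j(X_1,\dots,X_k)$, $1\le j\le n$, has at least one solution in $\mathbb F_q^t$.
   Context: Standing setup: $\mathbb F_q$ is a finite field with $q$ elements. Let $t,n,k$ be positive integers with $1\le k\le n$, and let $d_1>d_2>\cdots>d_t\ge 2$ be integers none divisible by the characteristic of $\mathbb F_q$. Let $A=(a_{ji})\in\mathbb F_q^{n\times t}$ satisfy hypothesis (H): every $n\times n$ submatrix of $A$ (formed by any choice of $n$ columns) has rank $n$. Let $g_1,\dots,g_n\in\mathbb F_q[X_1,\dots,X_k]$ be such that either (constant case) $g_j\in\mathbb F_q$ for all $j$, or (nonconstant case) $0\le\deg g_j<d_t$ for all $j$ and $\deg g_i>0$ for some $i$. -}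

module Defs where

open import Algebra.Apartness.Bundles using (HeytingField; HeytingCommutativeRing)
open import Algebra.Bundles using (CommutativeRing; Semiring)
open import Data.Fin.Base as Fin using (Fin; zero; fromℕ)
open import Data.List.Base using (List; []; _∷_; foldr)
open import Data.Nat.Base as ℕ using (ℕ; suc; NonZero; _≤_; _<_; _∸_)
import Data.Nat.Properties as ℕₚ
open import Data.Product.Base using (_×_; _,_; ∃-syntax)
open import Data.Vec.Base as Vec using (Vec)
open import Data.Vec.Functional using (Vector)
import Data.Vec.Properties as Vecₚ
open import Function.Bundles using (Inverse)
open import Level using (_⊔_)
open import Relation.Binary.Definitions using (Monotonic₁)
open import Relation.Binary.PropositionalEquality.Core using (_≡_)
import Relation.Binary.PropositionalEquality.Properties as ≡
open import Relation.Nullary.Decidable.Core using (yes; no)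
open import Relation.Nullary.Negation.Core using (¬_)

firstIndex : ∀ t → .{{NonZero t}} → Fin t
firstIndex (suc _) = zero

lastIndex : ∀ t → .{{NonZero t}} → Fin t
lastIndex (suc s) = fromℕ s

-- For s > 0, this is q > b ^ (r / s) with the s-th root cleared.
ExceedsRationalPower : (q b r s : ℕ) → Set
ExceedsRationalPower q b r s = b ℕ.^ r < q ℕ.^ s

k≤t : ∀ {k n t} → k ≤ n → 2 ℕ.* n ≤ t ∸ 1 → k ≤ t
k≤t {n = n} {t} k≤n 2n≤t-1 =
  ℕₚ.≤-trans k≤n
    (ℕₚ.≤-trans (ℕₚ.m≤n*m n 2) (ℕₚ.≤-trans 2n≤t-1 (ℕₚ.m∸n≤m t 1)))

module OverField {c ℓ₁ ℓ₂} (F : HeytingField c ℓ₁ ℓ₂) where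

  -- Only the commutative ring is used below.  In the presence of
  -- HasCardinality, equality is decidable and tightness forces x # y to be
  -- equivalent to ¬ (x ≈ y), so that a finite Heyting field is exactly a
  -- finite field.
  open HeytingCommutativeRing (HeytingField.heytingCommutativeRing F) public
    using (commutativeRing)
  open CommutativeRing commutativeRing public
    using (Carrier; _≈_; _+_; _*_; 0#; 1#; setoid; semiring)
  open import Algebra.Definitions.RawSemiring (Semiring.rawSemiring semiring) public
    using (_^_; sum; product)
    renaming (_×_ to _·_)

  HasCardinality : ℕ → Set (c ⊔ ℓ₁)
  HasCardinality q = Inverse setoid (≡.setoid (Fin q))

  HasPositiveCharacteristic : ℕ → Set ℓ₁
  HasPositiveCharacteristic p =
    0 < p × p · 1# ≈ 0# × (∀ m → 0 < m → m · 1# ≈ 0# → p ≤ m)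

  -- M j i is the entry in row j and column i.
  Matrix : ℕ → ℕ → Set c
  Matrix m n = Fin m → Fin n → Carrier

  LinearlyIndependent : ∀ {m s} → Vector (Vector Carrier m) s → Set (c ⊔ ℓ₁)
  LinearlyIndependent {m} {s} v =
    ∀ (a : Vector Carrier s) →
    (∀ j → sum (λ l → a l * v l j) ≈ 0#) → ∀ l → a l ≈ 0#

  selectColumns : ∀ {m n s} → Matrix m n → (Fin s → Fin n) → Matrix m s
  selectColumns M σ j l = M j (σ l)

  columns : ∀ {m n} → Matrix m n → Vector (Vector Carrier m) n
  columns M i j = M j i

  -- The largest size of a linearly independent family of columns.
  HasRank : ∀ {m n} → Matrix m n → ℕ → Set (c ⊔ ℓ₁)
  HasRank {m} {n} M r =
    (∃[ σ ] LinearlyIndependent (columns (selectColumns {s = r} M σ))) ×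
    (∀ s (σ : Fin s → Fin n) →
       LinearlyIndependent (columns (selectColumns M σ)) → s ≤ r)

  EveryMaximalSubmatrixHasFullRank : ∀ {n t} → Matrix n t → Set (c ⊔ ℓ₁)
  EveryMaximalSubmatrixHasFullRank {n} {t} A =
    ∀ (σ : Fin n → Fin t) → Monotonic₁ Fin._<_ Fin._<_ σ →
    HasRank (selectColumns A σ) n

  -- A formal sum of terms (coefficient , exponents).  An exponent vector may
  -- be repeated and coefficients may vanish or cancel, so everything about
  -- the polynomial itself (equality, degree) goes through coeff.
  Polynomial : ℕ → Set c
  Polynomial k = List (Carrier × Vec ℕ k)

  coeff : ∀ {k} → Polynomial k → Vec ℕ k → Carrier
  coeff []             e = 0#
  coeff ((a , e′) ∷ g) e with Vecₚ.≡-dec ℕₚ._≟_ e′ e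
  ... | yes _ = a + coeff g e
  ... | no  _ = coeff g e

  constant : ∀ {k} → Carrier → Polynomial k
  constant {k} a = (a , Vec.replicate k 0) ∷ []

  IsConstant : ∀ {k} → Polynomial k → Set (c ⊔ ℓ₁)
  IsConstant g = ∃[ a ] ∀ e → coeff g e ≈ coeff (constant a) e

  -- Total degree.  The zero polynomial has no degree in ℕ.
  HasDegree : ∀ {k} → Polynomial k → ℕ → Set ℓ₁
  HasDegree g m =
    (∃[ e ] Vec.sum e ≡ m × ¬ (coeff g e ≈ 0#)) ×
    (∀ e → ¬ (coeff g e ≈ 0#) → Vec.sum e ≤ m)

  evaluate : ∀ {k} → Polynomial k → Vector Carrier k → Carrier
  evaluate g x =
    foldr (λ (a , e) y → a * product (λ i → x i ^ Vec.lookup e i) + y) 0# g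

  ConstantCase : ∀ {n k} → Vector (Polynomial k) n → Set (c ⊔ ℓ₁)
  ConstantCase g = ∀ j → IsConstant (g j)

  -- The condition 0 ≤ deg (g j) is the existence of a degree in ℕ, that is,
  -- g j is not the zero polynomial.
  NonconstantCase : ∀ {n k} → Vector (Polynomial k) n → ℕ → Set ℓ₁
  NonconstantCase g dₜ =
    (∀ j → ∃[ m ] HasDegree (g j) m × m < dₜ) ×
    (∃[ i ] ∃[ m ] HasDegree (g i) m × 0 < m)

{-# OPTIONS --safe #-}
module Submission where

-- Write t = k + s and let h : F^k → F^n be h(x) = g(x) - Σ_{l<k} x_l^{d_l} a_l, with a_i the i-th column of A.
-- Let f(v) be the number of x with h(x) = v, and for the remaining indices i let
-- (M_i f)(v) = Σ_y f(v + y^{d_i} a_i).  The number of solutions is the value at 0 of (∏_i M_i) f.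
--
-- No characters are needed: everything is done with integer-valued functions on F^n and their ℓ²-norms.
--   * Fibres.  As deg g_j < d_l and the first k columns are independent, every monomial is, as a function on a
--     fibre of h, a combination of monomials with exponents below D = d_1.  These therefore span all functions
--     on the fibre, so fibres have at most D^k points and ‖f‖² ≤ q^k D^k.
--   * Gauss sums.  If f has zero sums along all lines in direction a, then T_b f(v) = Σ_y f(v + b y^d a)
--     satisfies Σ_b ‖T_b f‖² ≤ d q² ‖f‖², and T_{c^d} = T_1 for c ≠ 0, whence ‖T_1 f‖² ≤ (d+1) d q ‖f‖².
--   * Removing the columns one by one, split q f = P f + R, where P f is the sum along lines in direction a_i.
--     On P f, which is invariant in a new direction, M_i is multiplication by q, and R is controlled by the
--     previous point.  Once n independent directions of invariance are reached, a function with zero total sum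
--     vanishes; with fewer directions the invariance itself improves the bound on the value at 0.
-- Applied to the part of f with zero total sum, this shows that the main term q^{t-n} dominates the error term.

open import Algebra.Apartness.Bundles using (HeytingField)
open import Algebra.Bundles using (AbelianGroup; CommutativeMonoid; CommutativeRing; Semiring)
open import Algebra.Core using (Op₁; Op₂)
import Algebra.Definitions.RawSemiring as RawSemiringDefinitions
import Algebra.Morphism.RingMonomorphism as RingMonomorphism
open import Algebra.Morphism.Structures using (IsRingMonomorphism)
import Algebra.Properties.CommutativeSemiring.Exp as Exp
import Algebra.Properties.Group as GroupProperties
import Algebra.Properties.Semiring.Sum as SemiringSum
import Algebra.Solver.Ring.NaturalCoefficients.Default as SemiringSolver
open import Algebra.Structures using (IsCommutativeRing)
open import Data.Fin.Base as Fin using (Fin; zero; suc; inject≤)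
import Data.Fin.Properties as Finₚ
open import Data.Integer.Base as ℤ using (ℤ; +_)
import Data.Integer.Properties as ℤₚ
open import Data.Integer.Tactic.RingSolver using (solve-∀)
open import Data.List.Base as List using (List; []; _∷_)
open import Data.List.Membership.Propositional.Properties using (∈-filter⁺; ∈-allFin; ∈-lookup)
open import Data.List.Properties using (++-identityʳ; ++-assoc; length-++; length-tabulate; length-filter)
open import Data.List.Relation.Binary.Sublist.Propositional using (_⊆_; _∷ʳ_; ⊆-refl; ⊆-trans; []; _∷_; minimum)
open import Data.List.Relation.Binary.Sublist.Propositional.Properties using (++⁺; ++⁺ʳ; All-resp-⊆)
open import Data.List.Relation.Unary.All as All using (All; []; _∷_)
open import Data.List.Relation.Unary.All.Properties using (all-filter; ∷ʳ⁺; map⁺)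
open import Data.List.Relation.Unary.AllPairs using (AllPairs; []; _∷_)
open import Data.List.Relation.Unary.AllPairs.Properties using (tabulate⁺-<)
open import Data.Nat.Base as ℕ using (ℕ; zero; suc; NonZero; _≤_; _<_; _∸_; z≤n; s≤s)
open import Data.Nat.Divisibility using (_∤_)
import Data.Nat.Properties as ℕₚ
import Data.Nat.Tactic.RingSolver as ℕSolver
open import Data.Product.Base using (∃; _×_; _,_; proj₁; proj₂)
open import Data.Sum.Base using (_⊎_; inj₁; inj₂)
open import Data.Vec.Base as Vec using (Vec; []; _∷_; lookup)
import Data.Vec.Functional as VF
open import Data.Vec.Functional using (Vector)
import Data.Vec.Functional.Properties as VFₚ
import Data.Vec.Properties as Vecₚ
open import Defs
open import Function.Base using (_∘_)
open import Function.Bundles using (Inverse; _↔_; mk↔ₛ′)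
open import Function.Definitions using (Injective)
open import Function.Properties.Inverse using (↔-sym; ↔-trans)
open import Level using (0ℓ)
open import Relation.Binary.Core using (Rel)
open import Relation.Binary.Definitions using (DecidableEquality; Monotonic₁; Antitonic₁)
open import Relation.Binary.PropositionalEquality hiding (setoid)
import Relation.Binary.Reasoning.Setoid as SetoidReasoning
open import Relation.Nullary.Decidable.Core using (Dec; yes; no; ¬?)
open import Relation.Nullary.Negation.Core using (¬_; contradiction)
open import Relation.Unary using (Pred; Decidable)

-- Sums with a single nonzero term

module _ {c ℓ} (M : CommutativeMonoid c ℓ) where
  open CommutativeMonoid M renaming (trans to ≈-trans)
  open import Algebra.Properties.CommutativeMonoid.Sum M

  sum-single : ∀ {n} (f : Vector Carrier n) i → (∀ j → j ≢ i → f j ≈ ε) → sum f ≈ f i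
  sum-single {suc n} f zero f≈0 =
    ≈-trans (∙-congˡ (≈-trans (sum-cong-≋ (λ j → f≈0 (suc j) λ ())) (sum-replicate-zero n))) (identityʳ _)
  sum-single f (suc i) f≈0 = ≈-trans
    (∙-cong (f≈0 zero λ ()) (sum-single (f ∘ suc) i (λ j j≢i → f≈0 (suc j) (j≢i ∘ Finₚ.suc-injective))))
    (identityˡ _)

-- Finite types and the pigeonhole principle

record Finite (A : Set) : Set where
  field
    size : ℕ
    code : A ↔ Fin size
  encode : A → Fin size
  encode = Inverse.to code
  decode : Fin size → A
  decode = Inverse.from code
  encode-decode : ∀ i → encode (decode i) ≡ i
  encode-decode = Inverse.strictlyInverseˡ code
  decode-encode : ∀ x → decode (encode x) ≡ x
  decode-encode = Inverse.strictlyInverseʳ code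
  encode-injective : Injective _≡_ _≡_ encode
  encode-injective {x} {y} e = trans (sym (decode-encode x)) (trans (cong decode e) (decode-encode y))
  decode-injective : Injective _≡_ _≡_ decode
  decode-injective {x} {y} e = trans (sym (encode-decode x)) (trans (cong encode e) (encode-decode y))

  infix 4 _≟_
  _≟_ : DecidableEquality A
  x ≟ y with encode x Finₚ.≟ encode y
  ... | yes e = yes (encode-injective e)
  ... | no ne = no (ne ∘ cong encode)

open Finite ⦃ ... ⦄ using (_≟_)

#_ : (A : Set) → ⦃ Finite A ⦄ → ℕ
#_ A ⦃ F ⦄ = Finite.size F

instance
  finite-Fin : ∀ {n} → Finite (Fin n)
  finite-Fin {n} = record { size = n ; code = mk↔ₛ′ (λ x → x) (λ x → x) (λ _ → refl) (λ _ → refl) }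

  -- Vectors are coded by their digits in base `q`. The size is `q ^ n` by definition, so sums of
  -- constants over `Vec K n` give powers of `q` directly.
  finite-Vec : ∀ {A} {n} → ⦃ Finite A ⦄ → Finite (Vec A n)
  finite-Vec {A} {n} ⦃ F ⦄ = record { size = q ℕ.^ n ; code = mk↔ₛ′ (enc n) (dec n) (enc-dec n) (dec-enc n) }
    where
    open Finite F using (encode; decode; encode-decode; decode-encode) renaming (size to q)
    enc : ∀ n → Vec A n → Fin (q ℕ.^ n)
    enc zero    []      = zero
    enc (suc n) (x ∷ v) = Fin.combine (encode x) (enc n v)
    dec : ∀ n → Fin (q ℕ.^ n) → Vec A n
    dec zero    _ = []
    dec (suc n) i = decode (Fin.quotient {q} (q ℕ.^ n) i) ∷ dec n (Fin.remainder {q} (q ℕ.^ n) i)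
    enc-dec : ∀ n i → enc n (dec n i) ≡ i
    enc-dec zero    zero = refl
    enc-dec (suc n) i = trans
      (cong₂ Fin.combine (encode-decode _) (enc-dec n (Fin.remainder {q} (q ℕ.^ n) i)))
      (Finₚ.combine-remQuot {q} (q ℕ.^ n) i)
    dec-enc : ∀ n v → dec n (enc n v) ≡ v
    dec-enc zero    []      = refl
    dec-enc (suc n) (x ∷ v) = cong₂ _∷_
      (trans (cong (decode ∘ proj₁) (Finₚ.remQuot-combine (encode x) (enc n v))) (decode-encode x))
      (trans (cong (dec n ∘ proj₂) (Finₚ.remQuot-combine (encode x) (enc n v))) (dec-enc n v))

module _ {A B : Set} ⦃ FA : Finite A ⦄ ⦃ FB : Finite B ⦄ where
  injective⇒#≤# : {f : A → B} → Injective _≡_ _≡_ f → # A ≤ # B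
  injective⇒#≤# {f} inj = Finₚ.injective⇒≤ {f = Finite.encode FB ∘ f ∘ Finite.decode FA}
    (Finite.decode-injective FA ∘ inj ∘ Finite.encode-injective FB)

-- If `y` were missed, punching it out of the codomain would inject `Fin (suc n)` into `Fin n`.
Fin-injective⇒surjective : ∀ {n} {f : Fin n → Fin n} → Injective _≡_ _≡_ f → ∀ y → ∃ λ x → f x ≡ y
Fin-injective⇒surjective {suc n} {f} inj y with Finₚ.any? (λ x → f x Finₚ.≟ y)
... | yes p = p
... | no ¬p = contradiction
  (Finₚ.injective⇒≤ {f = λ x → Fin.punchOut (λ e → ¬p (x , sym e))}
    (λ {x} {x′} e → inj (Finₚ.punchOut-injective (λ e → ¬p (x , sym e)) (λ e → ¬p (x′ , sym e)) e)))
  (ℕₚ.<⇒≱ ℕₚ.≤-refl)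

injective⇒surjective : ∀ {A} ⦃ F : Finite A ⦄ {f : A → A} → Injective _≡_ _≡_ f → ∀ y → ∃ λ x → f x ≡ y
injective⇒surjective ⦃ F ⦄ {f} inj y =
  let x , e = Fin-injective⇒surjective {f = encode ∘ f ∘ decode} (decode-injective ∘ inj ∘ encode-injective) (encode y)
  in decode x , encode-injective e
  where open Finite F using (encode; decode; decode-injective; encode-injective)

-- Integer sums over a finite type

module ℤSum = SemiringSum ℤₚ.+-*-semiring

opaque
  ∑ : ∀ {A : Set} → ⦃ Finite A ⦄ → (A → ℤ) → ℤ
  ∑ ⦃ F ⦄ f = ℤSum.sum (f ∘ Finite.decode F)

⟦_⟧ : ∀ {p} {P : Set p} → Dec P → ℤ
⟦ yes _ ⟧ = + 1
⟦ no  _ ⟧ = + 0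

⟦⟧-cong : ∀ {p r} {P : Set p} {R : Set r} (P? : Dec P) (R? : Dec R) → (P → R) → (R → P) → ⟦ P? ⟧ ≡ ⟦ R? ⟧
⟦⟧-cong (yes _) (yes _) _ _ = refl
⟦⟧-cong (no  _) (no  _) _ _ = refl
⟦⟧-cong (yes p) (no ¬r) f _ = contradiction (f p) ¬r
⟦⟧-cong (no ¬p) (yes r) _ g = contradiction (g r) ¬p

sum-mono : ∀ {n} {f g : Fin n → ℤ} → (∀ i → f i ℤ.≤ g i) → ℤSum.sum f ℤ.≤ ℤSum.sum g
sum-mono {zero}  f≤g = ℤₚ.≤-refl
sum-mono {suc n} f≤g = ℤₚ.+-mono-≤ (f≤g zero) (sum-mono (f≤g ∘ suc))

sum-const : ∀ n z → ℤSum.sum {n} (λ _ → z) ≡ + n ℤ.* z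
sum-const zero    z = sym (ℤₚ.*-zeroˡ z)
sum-const (suc n) z = trans (cong (ℤ._+_ z) (sum-const n z)) (sym (ℤₚ.suc-* (+ n) z))

sum-≢0 : ∀ {n} (f : Fin n → ℤ) → ℤSum.sum f ≢ + 0 → ∃ λ i → f i ≢ + 0
sum-≢0 {zero}  f ne = contradiction refl ne
sum-≢0 {suc n} f ne with f zero ℤₚ.≟ + 0
... | no  f0≢0 = zero , f0≢0
... | yes f0≡0 =
  let i , p = sum-≢0 (f ∘ suc) (λ e → ne (cong₂ ℤ._+_ f0≡0 e)) in suc i , p

-- Enumerates the points that an indicator sum counts. Through it, `∑-count≤` turns a bound on the
-- length of every family of distinct points into a bound on the sum.
count : ∀ {p} n {P : Pred (Fin n) p} (P? : Decidable P) →
  ∃ λ N → ∃ λ (ι : Fin N → Fin n) → Injective _≡_ _≡_ ι × (∀ i → P (ι i)) × ℤSum.sum (λ i → ⟦ P? i ⟧) ≡ + N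
count zero    P? = 0 , (λ ()) , (λ { {()} }) , (λ ()) , refl
count (suc n) P? with P? zero | count n (P? ∘ suc)
... | no  _  | N , ι , inj , all , eq =
  N , suc ∘ ι , inj ∘ Finₚ.suc-injective , all , trans (ℤₚ.+-identityˡ _) eq
... | yes p0 | N , ι , inj , all , eq =
  suc N , ι′ , inj′ , all′ , cong (ℤ._+_ (+ 1)) eq
  where
  ι′ : Fin (suc N) → Fin (suc n)
  ι′ zero    = zero
  ι′ (suc i) = suc (ι i)
  inj′ : Injective _≡_ _≡_ ι′
  inj′ {zero}  {zero}  _ = refl
  inj′ {suc i} {suc j} e = cong suc (inj (Finₚ.suc-injective e))
  all′ : ∀ i → _
  all′ zero    = p0
  all′ (suc i) = all i

module _ {A : Set} ⦃ F : Finite A ⦄ where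
  open Finite F using (decode; encode; decode-encode; decode-injective; encode-injective; encode-decode)

  opaque
    unfolding ∑
    ∑-cong : {f g : A → ℤ} → (∀ x → f x ≡ g x) → ∑ f ≡ ∑ g
    ∑-cong f≗g = ℤSum.sum-cong-≗ (f≗g ∘ decode)

  opaque
    unfolding ∑
    ∑-+ : (f g : A → ℤ) → ∑ (λ x → f x ℤ.+ g x) ≡ ∑ f ℤ.+ ∑ g
    ∑-+ f g = ℤSum.∑-distrib-+ (f ∘ decode) (g ∘ decode)

  opaque
    unfolding ∑
    *-∑ : ∀ c (f : A → ℤ) → c ℤ.* ∑ f ≡ ∑ (λ x → c ℤ.* f x)
    *-∑ c f = ℤSum.*-distribˡ-sum c (f ∘ decode)

  opaque
    unfolding ∑
    ∑-mono : {f g : A → ℤ} → (∀ x → f x ℤ.≤ g x) → ∑ f ℤ.≤ ∑ g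
    ∑-mono f≤g = sum-mono (f≤g ∘ decode)

  opaque
    unfolding ∑
    ∑-const : ∀ c → ∑ (λ (_ : A) → c) ≡ + # A ℤ.* c
    ∑-const c = sum-const (# A) c

  opaque
    unfolding ∑
    ∑-≢0 : (f : A → ℤ) → ∑ f ≢ + 0 → ∃ λ x → f x ≢ + 0
    ∑-≢0 f ne = let i , p = sum-≢0 (f ∘ decode) ne in decode i , p

  ∑-≥0 : {f : A → ℤ} → (∀ x → + 0 ℤ.≤ f x) → + 0 ℤ.≤ ∑ f
  ∑-≥0 {f} f≥0 = subst (ℤ._≤ ∑ f) (trans (∑-const (+ 0)) (ℤₚ.*-zeroʳ (+ # A))) (∑-mono f≥0)

  opaque
    unfolding ∑
    ∑-single : ∀ {f : A → ℤ} a → (∀ x → x ≢ a → f x ≡ + 0) → ∑ f ≡ f a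
    ∑-single {f} a f≡0 = trans
      (sum-single (CommutativeRing.+-commutativeMonoid ℤₚ.+-*-commutativeRing) (f ∘ decode) (encode a)
        (λ j j≢ → f≡0 (decode j) (λ e → j≢ (trans (sym (encode-decode j)) (cong encode e)))))
      (cong f (decode-encode a))

  ∑-δ : ∀ a (f : A → ℤ) → ∑ (λ x → ⟦ x ≟ a ⟧ ℤ.* f x) ≡ f a
  ∑-δ a f = trans (∑-single a off) on
    where
    off : ∀ x → x ≢ a → ⟦ x ≟ a ⟧ ℤ.* f x ≡ + 0
    off x x≢a with x ≟ a
    ... | yes e = contradiction e x≢a
    ... | no  _ = ℤₚ.*-zeroˡ (f x)
    on : ⟦ a ≟ a ⟧ ℤ.* f a ≡ f a
    on with a ≟ a
    ... | yes _ = ℤₚ.*-identityˡ (f a)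
    ... | no ne = contradiction refl ne

  term≤∑ : {f : A → ℤ} → (∀ x → + 0 ℤ.≤ f x) → ∀ a → f a ℤ.≤ ∑ f
  term≤∑ {f} f≥0 a = subst (ℤ._≤ ∑ f) (∑-δ a f) (∑-mono le)
    where
    le : ∀ x → ⟦ x ≟ a ⟧ ℤ.* f x ℤ.≤ f x
    le x with x ≟ a
    ... | yes _ = ℤₚ.≤-reflexive (ℤₚ.*-identityˡ (f x))
    ... | no  _ = subst (ℤ._≤ f x) (sym (ℤₚ.*-zeroˡ (f x))) (f≥0 x)

  opaque
    unfolding ∑
    ∑-count≤ : ∀ {p} {P : Pred A p} (P? : Decidable P) D →
      (∀ N (pts : Fin N → A) → Injective _≡_ _≡_ pts → (∀ i → P (pts i)) → N ≤ D) →
      ∑ (λ x → ⟦ P? x ⟧) ℤ.≤ + D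
    ∑-count≤ P? D bound with count (# A) (P? ∘ decode)
    ... | N , ι , inj , all , eq =
      ℤₚ.≤-trans (ℤₚ.≤-reflexive eq) (ℤ.+≤+ (bound N (decode ∘ ι) (inj ∘ decode-injective) all))

module _ {A B : Set} ⦃ FA : Finite A ⦄ ⦃ FB : Finite B ⦄ where

  opaque
    unfolding ∑
    ∑-swap : (f : A → B → ℤ) → ∑ (λ x → ∑ (λ y → f x y)) ≡ ∑ (λ y → ∑ (λ x → f x y))
    ∑-swap f = ℤSum.∑-comm (λ i j → f (Finite.decode FA i) (Finite.decode FB j))

  opaque
    unfolding ∑
    ∑-reindex : (φ : A ↔ B) (f : B → ℤ) → ∑ (f ∘ Inverse.to φ) ≡ ∑ f
    ∑-reindex φ f = sym (trans
      (ℤSum.sum-permute (f ∘ Finite.decode FB) (↔-trans (↔-sym (Finite.code FA)) (↔-trans φ (Finite.code FB))))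
      (ℤSum.sum-cong-≗ {x = f ∘ Finite.decode FB ∘ Finite.encode FB ∘ Inverse.to φ ∘ Finite.decode FA} {y = f ∘ Inverse.to φ ∘ Finite.decode FA} (λ i → cong f (Finite.decode-encode FB (Inverse.to φ (Finite.decode FA i))))))

  ∑-*-∑ : (f : A → ℤ) (g : B → ℤ) → ∑ f ℤ.* ∑ g ≡ ∑ (λ x → ∑ (λ y → f x ℤ.* g y))
  ∑-*-∑ f g = begin
    ∑ f ℤ.* ∑ g                        ≡⟨ ℤₚ.*-comm (∑ f) (∑ g) ⟩
    ∑ g ℤ.* ∑ f                        ≡⟨ *-∑ (∑ g) f ⟩
    ∑ (λ x → ∑ g ℤ.* f x)              ≡⟨ ∑-cong (λ x → trans (ℤₚ.*-comm (∑ g) (f x)) (*-∑ (f x) g)) ⟩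
    ∑ (λ x → ∑ (λ y → f x ℤ.* g y))    ∎
    where open ≡-Reasoning

  -- Double counting: `f (φ x)` is written as a sum of `f y` against the indicator of `y = φ x`, and
  -- the two summations are exchanged.
  ∑-fibres : (φ : A → B) (f : B → ℤ) →
    ∑ (λ x → f (φ x)) ≡ ∑ (λ y → f y ℤ.* ∑ (λ x → ⟦ φ x ≟ y ⟧))
  ∑-fibres φ f = begin
    ∑ (λ x → f (φ x))                                  ≡⟨ ∑-cong (λ x → sym (∑-δ (φ x) f)) ⟩
    ∑ (λ x → ∑ (λ y → ⟦ y ≟ φ x ⟧ ℤ.* f y))            ≡⟨ ∑-swap _ ⟩
    ∑ (λ y → ∑ (λ x → ⟦ y ≟ φ x ⟧ ℤ.* f y))
      ≡⟨ ∑-cong (λ y → ∑-cong (λ x → trans (cong (ℤ._* f y) (swap y (φ x))) (ℤₚ.*-comm ⟦ φ x ≟ y ⟧ (f y)))) ⟩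
    ∑ (λ y → ∑ (λ x → f y ℤ.* ⟦ φ x ≟ y ⟧))            ≡⟨ ∑-cong (λ y → sym (*-∑ (f y) (λ x → ⟦ φ x ≟ y ⟧))) ⟩
    ∑ (λ y → f y ℤ.* ∑ (λ x → ⟦ φ x ≟ y ⟧))            ∎
    where
    open ≡-Reasoning
    swap : ∀ x y → ⟦ x ≟ y ⟧ ≡ ⟦ y ≟ x ⟧
    swap x y = ⟦⟧-cong (x ≟ y) (y ≟ x) sym sym

  ∑-fibres-≤ : (φ : A → B) (f : B → ℤ) → (∀ y → + 0 ℤ.≤ f y) → ∀ D →
    (∀ y → ∑ (λ x → ⟦ φ x ≟ y ⟧) ℤ.≤ + D) → ∑ (λ x → f (φ x)) ℤ.≤ + D ℤ.* ∑ f
  ∑-fibres-≤ φ f f≥0 D bound = begin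
    ∑ (λ x → f (φ x))                          ≡⟨ ∑-fibres φ f ⟩
    ∑ (λ y → f y ℤ.* ∑ (λ x → ⟦ φ x ≟ y ⟧))
      ≤⟨ ∑-mono (λ y → ℤₚ.*-monoˡ-≤-nonNeg (f y) ⦃ ℤ.nonNegative (f≥0 y) ⦄ (bound y)) ⟩
    ∑ (λ y → f y ℤ.* + D)                      ≡⟨ ∑-cong (λ y → ℤₚ.*-comm (f y) (+ D)) ⟩
    ∑ (λ y → + D ℤ.* f y)                      ≡⟨ *-∑ (+ D) f ⟨
    + D ℤ.* ∑ f                                ∎
    where open ℤₚ.≤-Reasoning

  ∑-injective-≤ : {φ : A → B} → Injective _≡_ _≡_ φ → (f : B → ℤ) → (∀ y → + 0 ℤ.≤ f y) →
    ∑ (λ x → f (φ x)) ℤ.≤ ∑ f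
  ∑-injective-≤ {φ} inj f f≥0 = subst (∑ (f ∘ φ) ℤ.≤_) (ℤₚ.*-identityˡ (∑ f))
    (∑-fibres-≤ φ f f≥0 1 (λ y → ∑-count≤ (λ x → φ x ≟ y) 1 (λ N pts pinj all →
      Finₚ.injective⇒≤ {f = λ _ → zero} (λ {i} {j} _ → pinj (inj (trans (all i) (sym (all j))))))))

lookup-ext : ∀ {a} {A : Set a} {n} {u v : Vec A n} → (∀ i → lookup u i ≡ lookup v i) → u ≡ v
lookup-ext {u = []}    {[]}    e = refl
lookup-ext {u = x ∷ u} {y ∷ v} e = cong₂ _∷_ (e zero) (lookup-ext (e ∘ suc))

-- Squares and squared norms of integer-valued functions

0≤i*i : ∀ i → + 0 ℤ.≤ i ℤ.* i
0≤i*i (+ n)      = subst (+ 0 ℤ.≤_) (ℤₚ.pos-* n n) (ℤ.+≤+ z≤n)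
0≤i*i ℤ.-[1+ n ] = ℤ.+≤+ z≤n

*-mono-≤-pos : ∀ n {i j} → i ℤ.≤ j → + n ℤ.* i ℤ.≤ + n ℤ.* j
*-mono-≤-pos n = ℤₚ.*-monoˡ-≤-nonNeg (+ n)

norm² : ∀ {A} ⦃ F : Finite A ⦄ → (A → ℤ) → ℤ
norm² f = ∑ (λ v → f v ℤ.* f v)

norm²≥0 : ∀ {A} ⦃ F : Finite A ⦄ (f : A → ℤ) → + 0 ℤ.≤ norm² f
norm²≥0 f = ∑-≥0 (λ v → 0≤i*i (f v))

-- The arithmetic of one inductive step of `total²≤`. Here `V` is the quantity to be bounded, `V₁`
-- and `V₂` are the contributions of the line sums and of the remainder, and `F` is the squared norm
-- of the function. After multiplication by q² both contributions are multiples of q³ y F, with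
-- factors 2 and 2 e, which explains the condition on `c`.
step-inequality : ∀ (q x y e c : ℕ) .⦃ _ : NonZero q ⦄ (F V V₁ V₂ NP NM NR : ℤ) → + 0 ℤ.≤ F → 2 ℕ.+ 2 ℕ.* e ≤ c →
  + q ℤ.* V ≡ + q ℤ.* V₁ ℤ.+ V₂ →
  + (q ℕ.* x) ℤ.* (V₁ ℤ.* V₁) ℤ.≤ + y ℤ.* NP → NP ℤ.≤ + q ℤ.* + q ℤ.* F →
  + x ℤ.* (V₂ ℤ.* V₂) ℤ.≤ + y ℤ.* NM → NM ℤ.≤ + e ℤ.* (+ q ℤ.* NR) → NR ℤ.≤ + q ℤ.* + q ℤ.* F →
  + x ℤ.* (V ℤ.* V) ℤ.≤ + (q ℕ.* y ℕ.* c) ℤ.* F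
step-inequality q@(suc _) x y e c F V V₁ V₂ NP NM NR F≥0 2+2e≤c qV h₁ hP h₂ hM hR =
  ℤₚ.*-cancelˡ-≤-pos (+ x ℤ.* (V ℤ.* V)) _ (+ q) (ℤₚ.*-cancelˡ-≤-pos (+ q ℤ.* (+ x ℤ.* (V ℤ.* V))) _ (+ q) (begin
    Q ℤ.* (Q ℤ.* (X ℤ.* (V ℤ.* V)))
      ≡⟨ trans (square Q X V) (cong (λ z → X ℤ.* (z ℤ.* z)) qV) ⟩
    X ℤ.* ((Q ℤ.* V₁ ℤ.+ V₂) ℤ.* (Q ℤ.* V₁ ℤ.+ V₂))
      -- The nonnegative term X (Q V₁ - V₂)² is added, so that the parallelogram identity removes
      -- the mixed products.
      ≤⟨ subst₂ ℤ._≤_ (ℤₚ.+-identityʳ _) (parallelogram Q X V₁ V₂) (ℤₚ.+-monoʳ-≤ (X ℤ.* ((Q ℤ.* V₁ ℤ.+ V₂) ℤ.* (Q ℤ.* V₁ ℤ.+ V₂)))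
           (subst (ℤ._≤ X ℤ.* ((Q ℤ.* V₁ ℤ.- V₂) ℤ.* (Q ℤ.* V₁ ℤ.- V₂))) (ℤₚ.*-zeroʳ X) (*-mono-≤-pos x (0≤i*i (Q ℤ.* V₁ ℤ.- V₂))))) ⟩
    + 2 ℤ.* (Q ℤ.* (Q ℤ.* X ℤ.* (V₁ ℤ.* V₁))) ℤ.+ + 2 ℤ.* (X ℤ.* (V₂ ℤ.* V₂))
      ≤⟨ ℤₚ.+-mono-≤ (*-mono-≤-pos 2 (*-mono-≤-pos q (subst (λ z → z ℤ.* (V₁ ℤ.* V₁) ℤ.≤ Y ℤ.* NP) (ℤₚ.pos-* q x) h₁))) (*-mono-≤-pos 2 h₂) ⟩
    + 2 ℤ.* (Q ℤ.* (Y ℤ.* NP)) ℤ.+ + 2 ℤ.* (Y ℤ.* NM)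
      ≤⟨ ℤₚ.+-mono-≤ (*-mono-≤-pos 2 (*-mono-≤-pos q (*-mono-≤-pos y hP)))
           (*-mono-≤-pos 2 (*-mono-≤-pos y (ℤₚ.≤-trans hM (*-mono-≤-pos e (*-mono-≤-pos q hR))))) ⟩
    + 2 ℤ.* (Q ℤ.* (Y ℤ.* (Q ℤ.* Q ℤ.* F))) ℤ.+ + 2 ℤ.* (Y ℤ.* (+ e ℤ.* (Q ℤ.* (Q ℤ.* Q ℤ.* F))))
      ≡⟨ collect Q Y (+ e) F ⟩
    Q ℤ.* (Q ℤ.* (Q ℤ.* Y ℤ.* ((+ 2 ℤ.+ + 2 ℤ.* + e) ℤ.* F)))
      ≤⟨ *-mono-≤-pos q (*-mono-≤-pos q (subst (λ z → z ℤ.* ((+ 2 ℤ.+ + 2 ℤ.* + e) ℤ.* F) ℤ.≤ z ℤ.* (+ c ℤ.* F)) (ℤₚ.pos-* q y)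
           (*-mono-≤-pos (q ℕ.* y) (ℤₚ.*-monoʳ-≤-nonNeg F ⦃ ℤ.nonNegative F≥0 ⦄ (subst (ℤ._≤ + c) (cong (ℤ._+_ (+ 2)) (ℤₚ.pos-* 2 e)) (ℤ.+≤+ 2+2e≤c)))))) ⟩
    Q ℤ.* (Q ℤ.* (Q ℤ.* Y ℤ.* (+ c ℤ.* F)))
      ≡⟨ cong (λ z → Q ℤ.* (Q ℤ.* z)) (trans (sym (ℤₚ.*-assoc (Q ℤ.* Y) (+ c) F)) (cong (ℤ._* F) (trans (cong (ℤ._* + c) (sym (ℤₚ.pos-* q y))) (sym (ℤₚ.pos-* (q ℕ.* y) c))))) ⟩
    Q ℤ.* (Q ℤ.* (+ (q ℕ.* y ℕ.* c) ℤ.* F)) ∎))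
  where
  open ℤₚ.≤-Reasoning
  Q = + q
  X = + x
  Y = + y
  square : ∀ Q X V → Q ℤ.* (Q ℤ.* (X ℤ.* (V ℤ.* V))) ≡ X ℤ.* ((Q ℤ.* V) ℤ.* (Q ℤ.* V))
  square = solve-∀
  parallelogram : ∀ Q X V W → X ℤ.* ((Q ℤ.* V ℤ.+ W) ℤ.* (Q ℤ.* V ℤ.+ W)) ℤ.+ X ℤ.* ((Q ℤ.* V ℤ.- W) ℤ.* (Q ℤ.* V ℤ.- W))
    ≡ + 2 ℤ.* (Q ℤ.* (Q ℤ.* X ℤ.* (V ℤ.* V))) ℤ.+ + 2 ℤ.* (X ℤ.* (W ℤ.* W))
  parallelogram = solve-∀
  collect : ∀ Q Y e F → + 2 ℤ.* (Q ℤ.* (Y ℤ.* (Q ℤ.* Q ℤ.* F))) ℤ.+ + 2 ℤ.* (Y ℤ.* (e ℤ.* (Q ℤ.* (Q ℤ.* Q ℤ.* F))))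
    ≡ Q ℤ.* (Q ℤ.* (Q ℤ.* Y ℤ.* ((+ 2 ℤ.+ + 2 ℤ.* e) ℤ.* F)))
  collect = solve-∀

-- Sublists

module _ {a} {A : Set a} where

  -- Completes a short list of columns to one of exactly the length to which hypothesis (H) applies.
  extend-⊆ : ∀ {xs ys : List A} → ys ⊆ xs → ∀ m → List.length ys ≤ m → m ≤ List.length xs →
    ∃ λ zs → ys ⊆ zs × zs ⊆ xs × List.length zs ≡ m
  extend-⊆ []            zero    _ _ = [] , [] , [] , refl
  extend-⊆ {x ∷ xs} (.x ∷ʳ ys⊆xs) m ys≤m m≤ with m ℕₚ.≟ suc (List.length xs)
  ... | yes refl = x ∷ xs , x ∷ʳ ys⊆xs , ⊆-refl , refl
  ... | no m≢ = let zs , p , r , e = extend-⊆ ys⊆xs m ys≤m (ℕₚ.≤-pred (ℕₚ.≤∧≢⇒< m≤ m≢)) in zs , p , x ∷ʳ r , e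
  extend-⊆ (refl ∷ ys⊆xs) (suc m) (s≤s ys≤m) (s≤s m≤) =
    let zs , p , r , e = extend-⊆ ys⊆xs m ys≤m m≤ in _ ∷ zs , refl ∷ p , refl ∷ r , cong suc e

  AllPairs-resp-⊆ : ∀ {ℓ} {R : Rel A ℓ} {xs ys : List A} → ys ⊆ xs → AllPairs R xs → AllPairs R ys
  AllPairs-resp-⊆ []             []         = []
  AllPairs-resp-⊆ (x ∷ʳ ys⊆xs)   (_ ∷ pxs)  = AllPairs-resp-⊆ ys⊆xs pxs
  AllPairs-resp-⊆ (refl ∷ ys⊆xs) (px ∷ pxs) = All-resp-⊆ ys⊆xs px ∷ AllPairs-resp-⊆ ys⊆xs pxs

  AllPairs-lookup : ∀ {ℓ} {R : Rel A ℓ} {xs : List A} → AllPairs R xs → ∀ {i j} → i Fin.< j → R (List.lookup xs i) (List.lookup xs j)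
  AllPairs-lookup (px ∷ pxs) {zero}  {suc j} _         = All.lookup px (∈-lookup j)
  AllPairs-lookup (px ∷ pxs) {suc i} {suc j} (s≤s i<j) = AllPairs-lookup pxs i<j

  tabulate-↑ˡ-⊆ : ∀ k s (f : Fin (k ℕ.+ s) → A) → List.tabulate (λ l → f (l Fin.↑ˡ s)) ⊆ List.tabulate f
  tabulate-↑ˡ-⊆ zero    s f = minimum _
  tabulate-↑ˡ-⊆ (suc k) s f = refl ∷ tabulate-↑ˡ-⊆ k s (f ∘ suc)

  tabulate-↑ʳ-⊆ : ∀ k s (f : Fin (k ℕ.+ s) → A) → List.tabulate (λ l → f (k Fin.↑ʳ l)) ⊆ List.tabulate f
  tabulate-↑ʳ-⊆ zero    s f = ⊆-refl
  tabulate-↑ʳ-⊆ (suc k) s f = f zero ∷ʳ tabulate-↑ʳ-⊆ k s (f ∘ suc)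

Fin-injective⇒permutation : ∀ {n} {f : Fin n → Fin n} → Injective _≡_ _≡_ f → Fin n ↔ Fin n
Fin-injective⇒permutation {f = f} inj = mk↔ₛ′ f (proj₁ ∘ onto) (proj₂ ∘ onto) (λ x → inj (proj₂ (onto (f x))))
  where onto = Fin-injective⇒surjective inj

-- Exponent vectors and their degrees

sum-replicate-0 : ∀ k → Vec.sum (Vec.replicate k 0) ≡ 0
sum-replicate-0 zero    = refl
sum-replicate-0 (suc k) = sum-replicate-0 k

sum-+ : ∀ {k} (e e′ : Vec ℕ k) → Vec.sum (Vec.zipWith ℕ._+_ e e′) ≡ Vec.sum e ℕ.+ Vec.sum e′
sum-+ [] [] = refl
sum-+ (m ∷ e) (m′ ∷ e′) = trans (cong (m ℕ.+ m′ ℕ.+_) (sum-+ e e′))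
  (ℕ-interchange m m′ (Vec.sum e) (Vec.sum e′))
  where
  ℕ-interchange : ∀ a b c d → (a ℕ.+ b) ℕ.+ (c ℕ.+ d) ≡ (a ℕ.+ c) ℕ.+ (b ℕ.+ d)
  ℕ-interchange = ℕSolver.solve-∀

sum-∸ : ∀ {k} (e : Vec ℕ k) l m → m ≤ lookup e l → Vec.sum (Vec.updateAt e l (_∸ m)) ℕ.+ m ≡ Vec.sum e
sum-∸ (a ∷ e) zero m m≤a = begin
  a ∸ m ℕ.+ Vec.sum e ℕ.+ m      ≡⟨ ℕₚ.+-assoc (a ∸ m) (Vec.sum e) m ⟩
  a ∸ m ℕ.+ (Vec.sum e ℕ.+ m)    ≡⟨ cong (a ∸ m ℕ.+_) (ℕₚ.+-comm (Vec.sum e) m) ⟩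
  a ∸ m ℕ.+ (m ℕ.+ Vec.sum e)    ≡⟨ ℕₚ.+-assoc (a ∸ m) m (Vec.sum e) ⟨
  a ∸ m ℕ.+ m ℕ.+ Vec.sum e      ≡⟨ cong (ℕ._+ Vec.sum e) (ℕₚ.m∸n+n≡m m≤a) ⟩
  a ℕ.+ Vec.sum e                ∎
  where open ≡-Reasoning
sum-∸ (a ∷ e) (suc l) m m≤ = trans (ℕₚ.+-assoc a _ m) (cong (a ℕ.+_) (sum-∸ e l m m≤))

-- Finite fields with underlying set `Fin q`

module FieldOnFin {q : ℕ} {add mul : Op₂ (Fin q)} {neg : Op₁ (Fin q)} {zer one : Fin q}
  (isCommutativeRing : IsCommutativeRing _≡_ add mul neg zer one)
  (inverse : ∀ x → x ≢ zer → ∃ λ y → mul y x ≡ one) (1<q : 1 < q) where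

  K : Set
  K = Fin q

  ring : CommutativeRing 0ℓ 0ℓ
  ring = record { isCommutativeRing = isCommutativeRing }

  open CommutativeRing ring public
    using (_+_; _*_; -_; 0#; 1#; semiring; commutativeSemiring; +-commutativeMonoid; *-assoc; *-comm; zeroˡ; zeroʳ;
           *-identityˡ; *-identityʳ; +-identityˡ; +-identityʳ; +-assoc; +-comm; distribˡ; distribʳ; -‿inverseˡ; -‿inverseʳ)
  open RawSemiringDefinitions (Semiring.rawSemiring semiring) public using (_^_; product)
  open Exp commutativeSemiring public using (^-homo-*; ^-distrib-*)
  open GroupProperties (CommutativeRing.+-group ring) public using (x∙y⁻¹≈ε⇒x≈y; ∙-cancelʳ)
  module KSum = SemiringSum semiring
  open SemiringSolver commutativeSemiring public using (solve; _:=_; _:+_; _:*_)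

  1≢0 : 1# ≢ 0#
  1≢0 1≡0 = contradiction (Finₚ.injective⇒≤ {f = λ (_ : K) → zero {0}} (λ {x} {y} _ → trans (≡0 x) (sym (≡0 y)))) (ℕₚ.<⇒≱ 1<q)
    where
    ≡0 : ∀ x → x ≡ 0#
    ≡0 x = trans (sym (*-identityˡ x)) (trans (cong (_* x) 1≡0) (zeroˡ x))

  no-zero-divisors : ∀ {x} y → x ≢ 0# → x * y ≡ 0# → y ≡ 0#
  no-zero-divisors {x} y x≢0 xy≡0 = let x⁻¹ , e = inverse x x≢0 in begin
    y              ≡⟨ *-identityˡ y ⟨
    1# * y         ≡⟨ cong (_* y) e ⟨
    (x⁻¹ * x) * y  ≡⟨ *-assoc x⁻¹ x y ⟩
    x⁻¹ * (x * y)  ≡⟨ cong (x⁻¹ *_) xy≡0 ⟩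
    x⁻¹ * 0#       ≡⟨ zeroʳ x⁻¹ ⟩
    0#             ∎
    where open ≡-Reasoning

  Independent : ∀ {n m} → (Fin n → Fin m → K) → Set
  Independent {m = m} A = ∀ (y : Fin m → K) → (∀ j → KSum.sum (λ l → y l * A j l) ≡ 0#) → ∀ l → y l ≡ 0#

  -- Monomials and polynomial functions

  monomial : ∀ {k} → Vec ℕ k → Vec K k → K
  monomial e x = product (λ i → lookup x i ^ lookup e i)

  evaluateTerms : ∀ {k} → List (K × Vec ℕ k) → Vec K k → K
  evaluateTerms g x = List.foldr (λ (a , e) y → a * monomial e x + y) 0# g

  -- A property of the function: some representing list has terms of low degree, whatever other
  -- expressions the function has. The zero function qualifies through the empty list.
  DegreeBelow : ∀ {k} → ℕ → (Vec K k → K) → Set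
  DegreeBelow {k} δ G = ∃ λ (g : List (K × Vec ℕ k)) →
    All (λ (_ , e) → Vec.sum e < δ) g × (∀ x → G x ≡ evaluateTerms g x)

  monomial-+ : ∀ {k} (e e′ : Vec ℕ k) x →
    monomial (Vec.zipWith ℕ._+_ e e′) x ≡ monomial e x * monomial e′ x
  monomial-+ [] [] [] = sym (*-identityˡ 1#)
  monomial-+ (m ∷ e) (m′ ∷ e′) (y ∷ x) = begin
    y ^ (m ℕ.+ m′) * monomial (Vec.zipWith ℕ._+_ e e′) x       ≡⟨ cong₂ _*_ (^-homo-* y m m′) (monomial-+ e e′ x) ⟩
    (y ^ m * y ^ m′) * (monomial e x * monomial e′ x)
      ≡⟨ interchange (y ^ m) (y ^ m′) (monomial e x) (monomial e′ x) ⟩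
    (y ^ m * monomial e x) * (y ^ m′ * monomial e′ x)          ∎
    where
    open ≡-Reasoning
    interchange : ∀ a b c d → (a * b) * (c * d) ≡ (a * c) * (b * d)
    interchange = solve 4 (λ a b c d → (a :* b) :* (c :* d) := (a :* c) :* (b :* d)) refl

  monomial-0 : ∀ {k} (x : Vec K k) → monomial (Vec.replicate k 0) x ≡ 1#
  monomial-0 []      = refl
  monomial-0 (y ∷ x) = trans (*-identityˡ _) (monomial-0 x)

  monomial-∸ : ∀ {k} (e : Vec ℕ k) l m → m ≤ lookup e l → ∀ x →
    monomial e x ≡ monomial (Vec.updateAt e l (_∸ m)) x * lookup x l ^ m
  monomial-∸ (a ∷ e) zero m m≤a (y ∷ x) = begin
    y ^ a * monomial e x                        ≡⟨ cong (λ a → y ^ a * monomial e x) (ℕₚ.m∸n+n≡m m≤a) ⟨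
    y ^ (a ∸ m ℕ.+ m) * monomial e x            ≡⟨ cong (_* monomial e x) (^-homo-* y (a ∸ m) m) ⟩
    (y ^ (a ∸ m) * y ^ m) * monomial e x        ≡⟨ rearrange (y ^ (a ∸ m)) (y ^ m) (monomial e x) ⟩
    (y ^ (a ∸ m) * monomial e x) * y ^ m        ∎
    where
    open ≡-Reasoning
    rearrange : ∀ a b c → (a * b) * c ≡ (a * c) * b
    rearrange = solve 3 (λ a b c → (a :* b) :* c := (a :* c) :* b) refl
  monomial-∸ (a ∷ e) (suc l) m m≤ (y ∷ x) =
    trans (cong (y ^ a *_) (monomial-∸ e l m m≤ x)) (sym (*-assoc _ _ _))

  monomial-suc : ∀ {k} (e : Vec ℕ k) l x → monomial (Vec.updateAt e l suc) x ≡ lookup x l * monomial e x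
  monomial-suc (a ∷ e) zero    (y ∷ x) = *-assoc y (y ^ a) (monomial e x)
  monomial-suc (a ∷ e) (suc l) (y ∷ x) = trans (cong (y ^ a *_) (monomial-suc e l x))
    (swap (y ^ a) (lookup x l) (monomial e x))
    where
    swap : ∀ a b c → a * (b * c) ≡ b * (a * c)
    swap = solve 3 (λ a b c → a :* (b :* c) := b :* (a :* c)) refl

  -- Fibres of a system whose leading forms are independent combinations of the pure powers x_l ^ d_l

  module Functional {k N} (pts : Fin N → Vec K k) where

    opaque
      -- Linear functionals supported on the given points. Bounding `N` amounts to showing that the
      -- weights are determined by the values on monomials with small exponents.
      L : (Fin N → K) → (Vec K k → K) → K
      L c P = KSum.sum (λ i → c i * P (pts i))

      L-cong : ∀ c {P Q} → (∀ i → P (pts i) ≡ Q (pts i)) → L c P ≡ L c Q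
      L-cong c e = KSum.sum-cong-≗ (λ i → cong (c i *_) (e i))

      L-+ : ∀ c P Q → L c (λ x → P x + Q x) ≡ L c P + L c Q
      L-+ c P Q = trans (KSum.sum-cong-≗ (λ i → distribˡ (c i) (P (pts i)) (Q (pts i)))) (KSum.∑-distrib-+ (λ i → c i * P (pts i)) (λ i → c i * Q (pts i)))

      L-* : ∀ c a P → L c (λ x → a * P x) ≡ a * L c P
      L-* c a P = trans (KSum.sum-cong-≗ (λ i → swap (c i) a (P (pts i)))) (sym (KSum.*-distribˡ-sum a (λ i → c i * P (pts i))))
        where
        swap : ∀ a b c → a * (b * c) ≡ b * (a * c)
        swap = solve 3 (λ a b c → a :* (b :* c) := b :* (a :* c)) refl

      L-sum : ∀ c {m} (P : Fin m → Vec K k → K) → L c (λ x → KSum.sum (λ l → P l x)) ≡ KSum.sum (λ l → L c (P l))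
      L-sum c P = trans
        (KSum.sum-cong-≗ (λ i → KSum.*-distribˡ-sum (c i) (λ l → P l (pts i))))
        (KSum.∑-comm (λ i l → c i * P l (pts i)))

      L-0 : ∀ c → L c (λ _ → 0#) ≡ 0#
      L-0 c = trans (KSum.sum-cong-≗ (λ i → zeroʳ (c i))) (KSum.sum-replicate-zero N)

      L-+ˡ : ∀ c c′ P → L (λ i → c i + c′ i) P ≡ L c P + L c′ P
      L-+ˡ c c′ P = trans (KSum.sum-cong-≗ (λ i → distribʳ (P (pts i)) (c i) (c′ i)))
        (KSum.∑-distrib-+ (λ i → c i * P (pts i)) (λ i → c′ i * P (pts i)))

      L-congˡ : ∀ {c c′} P → (∀ i → c i ≡ c′ i) → L c P ≡ L c′ P
      L-congˡ P e = KSum.sum-cong-≗ (λ i → cong (_* P (pts i)) (e i))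

      L-single : ∀ c P i → (∀ j → j ≢ i → c j * P (pts j) ≡ 0#) → L c P ≡ c i * P (pts i)
      L-single c P i off = sum-single +-commutativeMonoid (λ j → c j * P (pts j)) i off

    AnnihilatesMonomials : (Fin N → K) → Set
    AnnihilatesMonomials c = ∀ e → L c (monomial e) ≡ 0#

    module _ (injective : Injective _≡_ _≡_ pts) {c : Fin N → K} (ann : AnnihilatesMonomials c) where

      -- `P` is a product of linear factors, one for each `j` in `js`, taken in a coordinate where
      -- `pts j` and `pts i` differ. The annihilation property survives each factor because a
      -- coordinate times a monomial is again a monomial.
      separator : ∀ i js → All (_≢ i) js → ∃ λ (P : Vec K k → K) →
        (∀ e → L c (λ x → monomial e x * P x) ≡ 0#) × P (pts i) ≢ 0# × All (λ j → P (pts j) ≡ 0#) js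
      separator i [] [] =
        (λ _ → 1#) , (λ e → trans (L-cong c (λ i → *-identityʳ _)) (ann e)) , 1≢0 , []
      separator i (j ∷ js) (j≢i ∷ js≢i) with separator i js js≢i
      ... | P , annP , P≢0 , Pjs≡0 with Finₚ.all? (λ l → lookup (pts j) l Finₚ.≟ lookup (pts i) l)
      ...   | yes e = contradiction (injective (lookup-ext e)) j≢i
      ...   | no ne with Finₚ.¬∀⟶∃¬ k _ (λ l → lookup (pts j) l Finₚ.≟ lookup (pts i) l) ne
      ...     | l , ≢l = P′ , annP′ , P′≢0 , P′j≡0 ∷ All.map (λ {j′} Pj′≡0 → trans (cong ((lookup (pts j′) l + y) *_) Pj′≡0) (zeroʳ (lookup (pts j′) l + y))) Pjs≡0
        where
        y = - lookup (pts j) l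
        P′ : Vec K k → K
        P′ x = (lookup x l + y) * P x
        annP′ : ∀ e → L c (λ x → monomial e x * P′ x) ≡ 0#
        annP′ e = begin
          L c (λ x → monomial e x * P′ x)
            ≡⟨ L-cong c (λ i → expand (pts i)) ⟩
          L c (λ x → monomial (Vec.updateAt e l suc) x * P x + y * (monomial e x * P x))               ≡⟨ L-+ c _ _ ⟩
          L c (λ x → monomial (Vec.updateAt e l suc) x * P x) + L c (λ x → y * (monomial e x * P x))
            ≡⟨ cong₂ _+_ (annP (Vec.updateAt e l suc)) (trans (L-* c y _) (trans (cong (y *_) (annP e)) (zeroʳ y))) ⟩
          0# + 0#
            ≡⟨ +-identityˡ 0# ⟩
          0#                                                                                           ∎
          where
          open ≡-Reasoning
          algebra : ∀ m a y p → m * ((a + y) * p) ≡ (a * m) * p + y * (m * p)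
          algebra = solve 4 (λ m a y p → m :* ((a :+ y) :* p) := (a :* m) :* p :+ y :* (m :* p)) refl
          expand : ∀ x → monomial e x * P′ x ≡ monomial (Vec.updateAt e l suc) x * P x + y * (monomial e x * P x)
          expand x = trans (algebra (monomial e x) (lookup x l) y (P x))
            (cong (λ m → m * P x + y * (monomial e x * P x)) (sym (monomial-suc e l x)))
        P′≢0 : P′ (pts i) ≢ 0#
        P′≢0 e = P≢0 (no-zero-divisors (P (pts i)) (λ e → ≢l (sym (x∙y⁻¹≈ε⇒x≈y (lookup (pts i) l) (lookup (pts j) l) e))) e)
        P′j≡0 : P′ (pts j) ≡ 0#
        P′j≡0 = trans (cong (_* P (pts j)) (-‿inverseʳ (lookup (pts j) l))) (zeroˡ (P (pts j)))

      -- For a polynomial `P` vanishing at all points but the `i`-th, `L c P` reduces to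
      -- `c i * P (pts i)`; this product is zero, and `P (pts i)` is not.
      annihilator≡0 : ∀ i → c i ≡ 0#
      annihilator≡0 i with separator i (List.filter (λ j → ¬? (j Finₚ.≟ i)) (List.allFin N)) (all-filter (λ j → ¬? (j Finₚ.≟ i)) (List.allFin N))
      ... | P , annP , P≢0 , vanish = no-zero-divisors (c i) P≢0 (trans (*-comm (P (pts i)) (c i)) (begin
        c i * P (pts i)                                          ≡⟨ L-single c P i off ⟨
        L c P
          ≡⟨ L-cong c (λ j → trans (sym (*-identityˡ (P (pts j)))) (cong (_* P (pts j)) (sym (monomial-0 (pts j))))) ⟩
        L c (λ x → monomial (Vec.replicate k 0) x * P x)         ≡⟨ annP (Vec.replicate k 0) ⟩
        0#                                                       ∎))
        where
        open ≡-Reasoning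
        off : ∀ j → j ≢ i → c j * P (pts j) ≡ 0#
        off j j≢i = trans (cong (c j *_) (All.lookup vanish (∈-filter⁺ (λ j → ¬? (j Finₚ.≟ i)) (∈-allFin j) j≢i))) (zeroʳ (c j))

  module _ {k n : ℕ} (A : Fin n → Fin k → K)
    (independent : Independent A)
    (d : Fin k → ℕ) {δ D} (δ≤d : ∀ l → δ ≤ d l) (d≤D : ∀ l → d l ≤ D)
    {G : Fin n → Vec K k → K} (low : ∀ j → DegreeBelow δ (G j)) {N : ℕ} (pts : Fin N → Vec K k)
    (on : ∀ i j → KSum.sum (λ l → A j l * (lookup (pts i) l ^ d l)) ≡ G j (pts i)) where
    open Functional pts

    -- The numbers y l = L (x ^ e′ * x_l ^ d_l) satisfy A y = 0, since L (x ^ e′ * G j) only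
    -- involves monomials of degree smaller than that of x ^ e.
    reducedSuffices : ∀ c → (∀ e → (∀ l → lookup e l < D) → L c (monomial e) ≡ 0#) → AnnihilatesMonomials c
    reducedSuffices c reduced e = go (suc (Vec.sum e)) e ℕₚ.≤-refl
      where
      go : ∀ m e → Vec.sum e < m → L c (monomial e) ≡ 0#
      go (suc m) e (s≤s e≤m) with Finₚ.all? (λ l → lookup e l ℕₚ.<? d l)
      ... | yes e<d = reduced e (λ l → ℕₚ.<-≤-trans (e<d l) (d≤D l))
      ... | no e≮d with Finₚ.¬∀⟶∃¬ k _ (λ l → lookup e l ℕₚ.<? d l) e≮d
      -- `y l` is the value sought. Other entries of `y` may belong to monomials of higher degree,
      -- but independence makes all entries vanish at once, so the induction is applied only to the
      -- terms of `G j`.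
      ...   | l , el≮dl = trans (L-cong c (λ i → monomial-∸ e l (d l) dl≤el (pts i))) (independent y Ay≡0 l)
        where
        dl≤el = ℕₚ.≮⇒≥ el≮dl
        e′ = Vec.updateAt e l (_∸ d l)
        y : Fin k → K
        y l = L c (λ x → monomial e′ x * lookup x l ^ d l)
        lower : ∀ g → All (λ (_ , e) → Vec.sum e < δ) g → L c (λ x → monomial e′ x * evaluateTerms g x) ≡ 0#
        lower [] [] = trans (L-cong c (λ i → zeroʳ _)) (L-0 c)
        lower ((a , e″) ∷ g) (e″<δ ∷ g<δ) = begin
          L c (λ x → monomial e′ x * (a * monomial e″ x + evaluateTerms g x))
            ≡⟨ L-cong c (λ i → trans (algebra (monomial e′ (pts i)) a (monomial e″ (pts i)) (evaluateTerms g (pts i)))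
                 (cong (λ m → a * m + monomial e′ (pts i) * evaluateTerms g (pts i)) (sym (monomial-+ e′ e″ (pts i))))) ⟩
          L c (λ x → a * monomial (Vec.zipWith ℕ._+_ e′ e″) x + monomial e′ x * evaluateTerms g x)
            ≡⟨ L-+ c _ _ ⟩
          L c (λ x → a * monomial (Vec.zipWith ℕ._+_ e′ e″) x) + L c (λ x → monomial e′ x * evaluateTerms g x)
            ≡⟨ cong₂ _+_ (trans (L-* c a _) (cong (a *_) (go m (Vec.zipWith ℕ._+_ e′ e″) degree<m))) (lower g g<δ) ⟩
          a * 0# + 0#
            ≡⟨ trans (+-identityʳ _) (zeroʳ a) ⟩
          0# ∎
          where
          open ≡-Reasoning
          algebra : ∀ m a p r → m * (a * p + r) ≡ a * (m * p) + m * r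
          algebra = solve 4 (λ m a p r → m :* (a :* p :+ r) := a :* (m :* p) :+ m :* r) refl
          degree<m : Vec.sum (Vec.zipWith ℕ._+_ e′ e″) < m
          -- The factor x_l ^ d_l is replaced by a term of degree below `δ ≤ d l`, so the total
          -- degree drops.
          degree<m = ℕₚ.<-≤-trans (subst₂ _<_ (sym (sum-+ e′ e″)) (sum-∸ e l (d l) dl≤el)
            (ℕₚ.+-monoʳ-< (Vec.sum e′) (ℕₚ.<-≤-trans e″<δ (δ≤d l)))) e≤m
        Ay≡0 : ∀ j → KSum.sum (λ l → y l * A j l) ≡ 0#
        Ay≡0 j = begin
          KSum.sum (λ l → y l * A j l)
            ≡⟨ KSum.sum-cong-≗ (λ l → trans (*-comm (y l) (A j l)) (sym (L-* c (A j l) _))) ⟩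
          KSum.sum (λ l → L c (λ x → A j l * (monomial e′ x * lookup x l ^ d l)))
            ≡⟨ L-sum c (λ l x → A j l * (monomial e′ x * lookup x l ^ d l)) ⟨
          L c (λ x → KSum.sum (λ l → A j l * (monomial e′ x * lookup x l ^ d l)))
            ≡⟨ L-cong c (λ i → trans (KSum.sum-cong-≗ (λ l → swap (A j l) (monomial e′ (pts i)) (lookup (pts i) l ^ d l)))
                 (sym (KSum.*-distribˡ-sum (monomial e′ (pts i)) (λ l → A j l * lookup (pts i) l ^ d l)))) ⟩
          L c (λ x → monomial e′ x * KSum.sum (λ l → A j l * lookup x l ^ d l))
            ≡⟨ L-cong c (λ i → cong (monomial e′ (pts i) *_) (trans (on i j) (proj₂ (proj₂ (low j)) (pts i)))) ⟩
          L c (λ x → monomial e′ x * evaluateTerms (proj₁ (low j)) x)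
            ≡⟨ lower (proj₁ (low j)) (proj₁ (proj₂ (low j))) ⟩
          0# ∎
          where
          open ≡-Reasoning
          swap : ∀ a b c → a * (b * c) ≡ b * (a * c)
          swap = solve 3 (λ a b c → a :* (b :* c) := b :* (a :* c)) refl

    -- A dimension count by cardinality. `Φ` sends the weights to the values of `L` on the D^k
    -- reduced monomials. It is injective: weights that annihilate these monomials annihilate all
    -- monomials, hence vanish. So q^N is at most q^(D^k).
    fibre≤ : Injective _≡_ _≡_ pts → N ≤ D ℕ.^ k
    fibre≤ inj = ℕₚ.≮⇒≥ (λ D^k<N → ℕₚ.<⇒≱ (ℕₚ.^-monoʳ-< q 1<q D^k<N) (injective⇒#≤# {Vec K N} {Vec K (D ℕ.^ k)} {Φ} Φ-injective))
      where
      E : Fin (D ℕ.^ k) → Vec ℕ k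
      E i = Vec.map Fin.toℕ (Finite.decode (finite-Vec {Fin D} {k}) i)
      Φ : Vec K N → Vec K (D ℕ.^ k)
      Φ c = Vec.tabulate (λ i → L (lookup c) (monomial (E i)))
      Φ-injective : Injective _≡_ _≡_ Φ
      Φ-injective {c} {c′} Φc≡Φc′ = lookup-ext (λ i → x∙y⁻¹≈ε⇒x≈y _ _ (annihilator≡0 inj (reducedSuffices Δ reduced) i))
        where
        Δ : Fin N → K
        Δ i = lookup c i + - lookup c′ i
        L-Δ : ∀ P → L Δ P + L (lookup c′) P ≡ L (lookup c) P
        L-Δ P = trans (sym (L-+ˡ Δ (lookup c′) P)) (L-congˡ P (λ i →
          trans (+-assoc _ _ _) (trans (cong (_+_ (lookup c i)) (-‿inverseˡ _)) (+-identityʳ _))))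
        reduced : ∀ e → (∀ l → lookup e l < D) → L Δ (monomial e) ≡ 0#
        reduced e e<D = ∙-cancelʳ (L (lookup c′) (monomial e)) _ _ (begin
          L Δ (monomial e) + L (lookup c′) (monomial e)  ≡⟨ L-Δ (monomial e) ⟩
          L (lookup c) (monomial e)
            ≡⟨ subst (λ e → L (lookup c) (monomial e) ≡ L (lookup c′) (monomial e)) Ei≡e same ⟩
          L (lookup c′) (monomial e)                     ≡⟨ +-identityˡ _ ⟨
          0# + L (lookup c′) (monomial e)                ∎)
          where
          open ≡-Reasoning
          ê : Vec (Fin D) k
          ê = Vec.tabulate (λ l → Fin.fromℕ< (e<D l))
          i = Finite.encode finite-Vec ê
          Ei≡e : E i ≡ e
          Ei≡e = trans (cong (Vec.map Fin.toℕ) (Finite.decode-encode finite-Vec ê)) (lookup-ext (λ l →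
            trans (Vecₚ.lookup-map l Fin.toℕ ê) (trans (cong Fin.toℕ (Vecₚ.lookup∘tabulate _ l)) (Finₚ.toℕ-fromℕ< (e<D l)))))
          same : L (lookup c) (monomial (E i)) ≡ L (lookup c′) (monomial (E i))
          same = trans (sym (Vecₚ.lookup∘tabulate _ i)) (trans (cong (λ v → lookup v i) Φc≡Φc′) (Vecₚ.lookup∘tabulate _ i))

  -- The vector space `Vec K n` and substitutions in sums

  infixl 6 _⊕_
  infixr 8 _⊙_

  _⊕_ : ∀ {n} → Vec K n → Vec K n → Vec K n
  _⊕_ = Vec.zipWith _+_

  _⊙_ : ∀ {n} → K → Vec K n → Vec K n
  c ⊙ v = Vec.map (c *_) v

  𝟎 : ∀ {n} → Vec K n
  𝟎 = Vec.replicate _ 0#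

  ⊕-assoc : ∀ {n} (u v w : Vec K n) → (u ⊕ v) ⊕ w ≡ u ⊕ (v ⊕ w)
  ⊕-assoc = Vecₚ.zipWith-assoc +-assoc

  ⊕-comm : ∀ {n} (u v : Vec K n) → u ⊕ v ≡ v ⊕ u
  ⊕-comm = Vecₚ.zipWith-comm +-comm

  ⊕-identityˡ : ∀ {n} (v : Vec K n) → 𝟎 ⊕ v ≡ v
  ⊕-identityˡ = Vecₚ.zipWith-identityˡ +-identityˡ

  ⊕-identityʳ : ∀ {n} (v : Vec K n) → v ⊕ 𝟎 ≡ v
  ⊕-identityʳ = Vecₚ.zipWith-identityʳ +-identityʳ

  ⊕-inverseʳ : ∀ {n} (v : Vec K n) → v ⊕ Vec.map -_ v ≡ 𝟎
  ⊕-inverseʳ = Vecₚ.zipWith-inverseʳ -‿inverseʳ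

  ⊙-distribʳ : ∀ {n} b c (v : Vec K n) → (b + c) ⊙ v ≡ b ⊙ v ⊕ c ⊙ v
  ⊙-distribʳ b c []      = refl
  ⊙-distribʳ b c (x ∷ v) = cong₂ _∷_ (distribʳ x b c) (⊙-distribʳ b c v)

  0⊙ : ∀ {n} (v : Vec K n) → 0# ⊙ v ≡ 𝟎
  0⊙ []      = refl
  0⊙ (x ∷ v) = cong₂ _∷_ (zeroˡ x) (0⊙ v)

  ⊕-collect : ∀ {n} (v : Vec K n) b c a → v ⊕ b ⊙ a ⊕ c ⊙ a ≡ v ⊕ (b + c) ⊙ a
  ⊕-collect v b c a = trans (⊕-assoc v (b ⊙ a) (c ⊙ a)) (cong (v ⊕_) (sym (⊙-distribʳ b c a)))

  ⊕-swap : ∀ {n} (u v w : Vec K n) → u ⊕ v ⊕ w ≡ u ⊕ w ⊕ v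
  ⊕-swap u v w = trans (⊕-assoc u v w) (trans (cong (u ⊕_) (⊕-comm v w)) (sym (⊕-assoc u w v)))

  ∑-translate : ∀ {n} u (f : Vec K n → ℤ) → ∑ (λ v → f (v ⊕ u)) ≡ ∑ f
  ∑-translate u f = ∑-reindex (mk↔ₛ′ (_⊕ u) (_⊕ Vec.map -_ u) (cancel′ u) (cancel u)) f
    where
    cancel : ∀ u v → v ⊕ u ⊕ Vec.map -_ u ≡ v
    cancel u v = trans (⊕-assoc v u _) (trans (cong (v ⊕_) (⊕-inverseʳ u)) (⊕-identityʳ v))
    cancel′ : ∀ u v → v ⊕ Vec.map -_ u ⊕ u ≡ v
    cancel′ u v = trans (⊕-swap v (Vec.map -_ u) u) (cancel u v)

  ∑-shift : ∀ c (f : K → ℤ) → ∑ (λ x → f (c + x)) ≡ ∑ f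
  ∑-shift c f = ∑-reindex (mk↔ₛ′ (_+_ c) (_+_ (- c)) right left) f
    where
    right : ∀ x → c + (- c + x) ≡ x
    right x = trans (sym (+-assoc c (- c) x)) (trans (cong (_+ x) (-‿inverseʳ c)) (+-identityˡ x))
    left : ∀ x → - c + (c + x) ≡ x
    left x = trans (sym (+-assoc (- c) c x)) (trans (cong (_+ x) (-‿inverseˡ c)) (+-identityˡ x))

  ∑-scale : ∀ c → c ≢ 0# → (f : K → ℤ) → ∑ (λ x → f (c * x)) ≡ ∑ f
  ∑-scale c c≢0 f = let c⁻¹ , e = inverse c c≢0 in ∑-reindex (mk↔ₛ′ (c *_) (c⁻¹ *_)
    (λ x → trans (sym (*-assoc c c⁻¹ x)) (trans (cong (_* x) (trans (*-comm c c⁻¹) e)) (*-identityˡ x)))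
    (λ x → trans (sym (*-assoc c⁻¹ c x)) (trans (cong (_* x) e) (*-identityˡ x)))) f

  -- Sums over powers along a line and their norms

  roots≤ : ∀ d → 1 ≤ d → ∀ c → ∑ (λ x → ⟦ x ^ d ≟ c ⟧) ℤ.≤ + d
  -- The one-variable system with matrix (1) and constant right-hand side `c`, which has degree
  -- below `δ = 1`; the fibre bound `d ^ 1` is then the classical bound for the roots of x^d = c.
  roots≤ d 1≤d c = ∑-count≤ (λ x → x ^ d ≟ c) d (λ N pts inj on → subst (N ≤_) (ℕₚ.*-identityʳ d)
    (fibre≤ {k = 1} {n = 1} (λ _ _ → 1#)
      (λ { y e zero → trans (sym (trans (+-identityʳ (y zero * 1#)) (*-identityʳ (y zero)))) (e zero) })
      (λ _ → d) {δ = 1} (λ _ → 1≤d) (λ _ → ℕₚ.≤-refl) {G = λ _ _ → c}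
      (λ _ → (c , 0 ∷ []) ∷ [] , s≤s z≤n ∷ [] , λ { (x ∷ []) → sym (trans (+-identityʳ _) (trans (cong (c *_) (*-identityˡ 1#)) (*-identityʳ c))) })
      (λ i → pts i ∷ [])
      (λ i _ → trans (+-identityʳ _) (trans (*-identityˡ _) (on i)))
      (λ e → inj (Vecₚ.∷-injectiveˡ e))))

  -- The general `κ` covers three kernels: the identity for line sums, `_^ d` for the operators of
  -- the counting problem, and `b * x ^ d` for the averaged family in the norm estimate.
  convolve : ∀ {n} → Vec K n → (K → K) → (Vec K n → ℤ) → Vec K n → ℤ
  convolve a κ f v = ∑ (λ x → f (v ⊕ κ x ⊙ a))

  lineSum : ∀ {n} → Vec K n → (Vec K n → ℤ) → Vec K n → ℤ
  lineSum a = convolve a (λ x → x)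

  -- If b ranges over the field, then Σ_b ‖T b‖² is computed exactly; as T (c ^ d) = T 1 for c ≢ 0,
  -- the term ‖T 1‖² occurs in it with multiplicity at least (q - 1) / d.
  module _ {n} (a : Vec K n) (d : ℕ) (1≤d : 1 ≤ d) (f : Vec K n → ℤ) (f-line : ∀ v → lineSum a f v ≡ + 0) where
    private
      T : K → Vec K n → ℤ
      T b = convolve a (λ x → b * x ^ d) f
      T² : K → ℤ
      T² b = norm² (T b)

    -- Translating `v` leaves the products of f(v) and f(v + b (y^d - x^d) a). If the two powers
    -- differ, `b` runs through a full line, where `f` sums to zero; if they agree, each of the `q`
    -- values of `b` contributes ‖f‖².
    correlation : ∀ x y → ∑ (λ b → ∑ (λ v → f (v ⊕ (b * x ^ d) ⊙ a) ℤ.* f (v ⊕ (b * y ^ d) ⊙ a)))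
      ≡ ⟦ y ^ d ≟ x ^ d ⟧ ℤ.* (+ q ℤ.* norm² f)
    correlation x y = begin
      ∑ (λ b → ∑ (λ v → f (v ⊕ (b * x ^ d) ⊙ a) ℤ.* f (v ⊕ (b * y ^ d) ⊙ a)))
        ≡⟨ ∑-cong (λ b → trans (∑-cong (λ v → cong (λ w → f (v ⊕ (b * x ^ d) ⊙ a) ℤ.* f w) (sym (move v b)))) (∑-translate ((b * x ^ d) ⊙ a) (λ v → f v ℤ.* f (v ⊕ (δ * b) ⊙ a)))) ⟩
      ∑ (λ b → ∑ (λ v → f v ℤ.* f (v ⊕ (δ * b) ⊙ a)))                            ≡⟨ ∑-swap _ ⟩
      ∑ (λ v → ∑ (λ b → f v ℤ.* f (v ⊕ (δ * b) ⊙ a)))                            ≡⟨ ∑-cong (λ v → sym (*-∑ (f v) _)) ⟩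
      ∑ (λ v → f v ℤ.* ∑ (λ b → f (v ⊕ (δ * b) ⊙ a)))
        ≡⟨ ∑-cong (λ v → trans (cong (ℤ._*_ (f v)) (along v)) (rearrange (f v) ⟦ y ^ d ≟ x ^ d ⟧ (+ q))) ⟩
      ∑ (λ v → ⟦ y ^ d ≟ x ^ d ⟧ ℤ.* + q ℤ.* (f v ℤ.* f v))                      ≡⟨ *-∑ (⟦ y ^ d ≟ x ^ d ⟧ ℤ.* + q) _ ⟨
      ⟦ y ^ d ≟ x ^ d ⟧ ℤ.* + q ℤ.* norm² f
        ≡⟨ ℤₚ.*-assoc ⟦ y ^ d ≟ x ^ d ⟧ (+ q) (norm² f) ⟩
      ⟦ y ^ d ≟ x ^ d ⟧ ℤ.* (+ q ℤ.* norm² f)                                    ∎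
      where
      open ≡-Reasoning
      δ = y ^ d + - (x ^ d)
      rearrange : ∀ a b c → a ℤ.* (b ℤ.* (c ℤ.* a)) ≡ b ℤ.* c ℤ.* (a ℤ.* a)
      rearrange = solve-∀
      scalars : ∀ b → b * x ^ d + δ * b ≡ b * y ^ d
      scalars b = begin
        b * x ^ d + δ * b                ≡⟨ cong (_+_ (b * x ^ d)) (*-comm δ b) ⟩
        b * x ^ d + b * δ                ≡⟨ distribˡ b (x ^ d) δ ⟨
        b * (x ^ d + δ)                  ≡⟨ cong (b *_) (+-comm (x ^ d) δ) ⟩
        b * (δ + x ^ d)
          ≡⟨ cong (b *_) (trans (+-assoc (y ^ d) (- (x ^ d)) (x ^ d)) (trans (cong (_+_ (y ^ d)) (-‿inverseˡ (x ^ d))) (+-identityʳ (y ^ d)))) ⟩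
        b * y ^ d                        ∎
      move : ∀ v b → v ⊕ (b * x ^ d) ⊙ a ⊕ (δ * b) ⊙ a ≡ v ⊕ (b * y ^ d) ⊙ a
      move v b = trans (⊕-collect v _ _ a) (cong (λ c → v ⊕ c ⊙ a) (scalars b))
      along : ∀ v → ∑ (λ b → f (v ⊕ (δ * b) ⊙ a)) ≡ ⟦ y ^ d ≟ x ^ d ⟧ ℤ.* (+ q ℤ.* f v)
      along v with y ^ d ≟ x ^ d
      ... | no ne = trans (∑-scale δ (λ e → ne (x∙y⁻¹≈ε⇒x≈y _ _ e)) (λ b → f (v ⊕ b ⊙ a))) (trans (f-line v) (sym (ℤₚ.*-zeroˡ (+ q ℤ.* f v))))
      ... | yes e = trans (∑-cong (λ b → cong f (constant b))) (trans (∑-const (f v)) (sym (ℤₚ.*-identityˡ (+ q ℤ.* f v))))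
        where
        constant : ∀ b → v ⊕ (δ * b) ⊙ a ≡ v
        constant b = trans (cong (λ c → v ⊕ c ⊙ a) (trans (cong (_* b) (trans (cong (_+ - (x ^ d)) e) (-‿inverseʳ (x ^ d)))) (zeroˡ b)))
          (trans (cong (v ⊕_) (0⊙ a)) (⊕-identityʳ v))

    -- Expanding the squares yields all correlations. For each of the `q` values of `x`, at most `d`
    -- values of `y` satisfy `y ^ d ≡ x ^ d`, and only these contribute.
    ∑-T² : ∑ T² ℤ.≤ + q ℤ.* (+ d ℤ.* (+ q ℤ.* norm² f))
    ∑-T² = begin
      ∑ T²
        ≡⟨ ∑-cong (λ b → ∑-cong (λ v → ∑-*-∑ (λ x → F b v x) (λ y → F b v y))) ⟩
      ∑ (λ b → ∑ (λ v → ∑ (λ x → ∑ (λ y → F b v x ℤ.* F b v y))))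
        ≡⟨ ∑-cong (λ b → trans (∑-swap _) (∑-cong (λ x → ∑-swap _))) ⟩
      ∑ (λ b → ∑ (λ x → ∑ (λ y → ∑ (λ v → F b v x ℤ.* F b v y))))
        ≡⟨ trans (∑-swap _) (∑-cong (λ x → ∑-swap _)) ⟩
      ∑ (λ x → ∑ (λ y → ∑ (λ b → ∑ (λ v → F b v x ℤ.* F b v y))))
        ≡⟨ ∑-cong (λ x → trans (∑-cong (λ y → trans (correlation x y) (ℤₚ.*-comm ⟦ y ^ d ≟ x ^ d ⟧ Q))) (sym (*-∑ Q _))) ⟩
      ∑ (λ x → Q ℤ.* ∑ (λ y → ⟦ y ^ d ≟ x ^ d ⟧))
        ≤⟨ ∑-mono (λ x → ℤₚ.*-monoˡ-≤-nonNeg Q ⦃ ℤ.nonNegative Q≥0 ⦄ (roots≤ d 1≤d (x ^ d))) ⟩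
      ∑ (λ (x : K) → Q ℤ.* + d)
        ≡⟨ trans (∑-const (Q ℤ.* + d)) (cong (ℤ._*_ (+ q)) (ℤₚ.*-comm Q (+ d))) ⟩
      + q ℤ.* (+ d ℤ.* Q) ∎
      where
      open ℤₚ.≤-Reasoning
      F : K → Vec K n → K → ℤ
      F b v x = f (v ⊕ (b * x ^ d) ⊙ a)
      Q = + q ℤ.* norm² f
      Q≥0 : + 0 ℤ.≤ Q
      Q≥0 = subst (ℤ._≤ Q) (ℤₚ.*-zeroʳ (+ q)) (*-mono-≤-pos q (norm²≥0 f))

    -- The substitution x ↦ c x permutes the field and turns `x ^ d` into `c ^ d * x ^ d`.
    T-power : ∀ c → c ≢ 0# → ∀ v → T (c ^ d) v ≡ T 1# v
    T-power c c≢0 v = trans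
      (∑-cong (λ x → cong (λ s → f (v ⊕ s ⊙ a)) (trans (sym (^-distrib-* c x d)) (sym (*-identityˡ ((c * x) ^ d))))))
      (∑-scale c c≢0 (λ x → f (v ⊕ (1# * x ^ d) ⊙ a)))

    powerSum-norm² : norm² (convolve a (_^ d) f) ℤ.≤ + (suc d ℕ.* d) ℤ.* (+ q ℤ.* norm² f)
    powerSum-norm² = begin
      norm² (convolve a (_^ d) f)      ≡⟨ ∑-cong (λ v → cong₂ ℤ._*_ (to1 v) (to1 v)) ⟩
      T² 1#
        ≤⟨ ℤₚ.*-cancelˡ-≤-pos (T² 1#) _ (+ q) ⦃ ℤ.positive (ℤ.+<+ (ℕₚ.<-trans (s≤s z≤n) 1<q)) ⦄ q*T²1≤ ⟩
      + (suc d ℕ.* d) ℤ.* (+ q ℤ.* norm² f) ∎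
      where
      open ℤₚ.≤-Reasoning
      to1 : ∀ v → convolve a (_^ d) f v ≡ T 1# v
      to1 v = ∑-cong (λ x → cong (λ s → f (v ⊕ s ⊙ a)) (sym (*-identityˡ (x ^ d))))
      T²≥0 : ∀ b → + 0 ℤ.≤ T² b
      T²≥0 b = norm²≥0 (T b)
      pointwise : ∀ c → T² 1# ℤ.≤ T² (c ^ d) ℤ.+ ⟦ c ≟ 0# ⟧ ℤ.* T² 1#
      pointwise c with c ≟ 0#
      ... | yes _ = subst (ℤ._≤ T² (c ^ d) ℤ.+ + 1 ℤ.* T² 1#) (trans (ℤₚ.+-identityˡ _) (ℤₚ.*-identityˡ (T² 1#))) (ℤₚ.+-monoˡ-≤ (+ 1 ℤ.* T² 1#) (T²≥0 (c ^ d)))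
      ... | no ne = ℤₚ.≤-reflexive (sym (trans (cong (λ z → T² (c ^ d) ℤ.+ z) (ℤₚ.*-zeroˡ (T² 1#))) (trans (ℤₚ.+-identityʳ (T² (c ^ d)))
          (∑-cong (λ v → cong₂ ℤ._*_ (T-power c ne v) (T-power c ne v))))))
      q*T²1≤ : + q ℤ.* T² 1# ℤ.≤ + q ℤ.* (+ (suc d ℕ.* d) ℤ.* (+ q ℤ.* norm² f))
      q*T²1≤ = begin
        + q ℤ.* T² 1#                                              ≡⟨ ∑-const {K} (T² 1#) ⟨
        ∑ (λ (c : K) → T² 1#)                                      ≤⟨ ∑-mono pointwise ⟩
        ∑ (λ c → T² (c ^ d) ℤ.+ ⟦ c ≟ 0# ⟧ ℤ.* T² 1#)
          ≡⟨ trans (∑-+ _ _) (cong (λ z → ∑ (λ c → T² (c ^ d)) ℤ.+ z) (∑-δ 0# (λ _ → T² 1#))) ⟩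
        ∑ (λ c → T² (c ^ d)) ℤ.+ T² 1#
          -- Each field element is the `d`-th power of at most `d` elements.
          ≤⟨ ℤₚ.+-mono-≤ (∑-fibres-≤ (_^ d) T² T²≥0 d (roots≤ d 1≤d)) (term≤∑ T²≥0 1#) ⟩
        + d ℤ.* ∑ T² ℤ.+ ∑ T²
          ≡⟨ trans (ℤₚ.+-comm (+ d ℤ.* ∑ T²) (∑ T²)) (sym (ℤₚ.suc-* (+ d) (∑ T²))) ⟩
        + suc d ℤ.* ∑ T²                                           ≤⟨ *-mono-≤-pos (suc d) ∑-T² ⟩
        + suc d ℤ.* (+ q ℤ.* (+ d ℤ.* (+ q ℤ.* norm² f)))
          ≡⟨ rearrange (+ suc d) (+ q) (+ d) (+ q ℤ.* norm² f) ⟩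
        + q ℤ.* (+ suc d ℤ.* + d ℤ.* (+ q ℤ.* norm² f))
          ≡⟨ cong (λ z → + q ℤ.* (z ℤ.* (+ q ℤ.* norm² f))) (sym (ℤₚ.pos-* (suc d) d)) ⟩
        + q ℤ.* (+ (suc d ℕ.* d) ℤ.* (+ q ℤ.* norm² f))            ∎
        where
        rearrange : ∀ a b c e → a ℤ.* (b ℤ.* (c ℤ.* e)) ≡ b ℤ.* (a ℤ.* c ℤ.* e)
        rearrange = solve-∀

  -- Orthogonal splitting into line sums and remainder

  module _ {n} (a : Vec K n) (f : Vec K n → ℤ) where

    lineSum-invariant : ∀ v y → lineSum a f (v ⊕ y ⊙ a) ≡ lineSum a f v
    lineSum-invariant v y = trans (∑-cong (λ x → cong f (⊕-collect v y x a))) (∑-shift y (λ x → f (v ⊕ x ⊙ a)))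

    -- `q` times the difference between `f` and its average over lines in direction `a`, scaled so
    -- that the values remain integers.
    remainder : Vec K n → ℤ
    remainder v = + q ℤ.* f v ℤ.- lineSum a f v

    remainder-lineSum : ∀ v → lineSum a remainder v ≡ + 0
    remainder-lineSum v = begin
      ∑ (λ y → + q ℤ.* f (v ⊕ y ⊙ a) ℤ.- lineSum a f (v ⊕ y ⊙ a))
        ≡⟨ ∑-cong (λ y → cong (λ z → + q ℤ.* f (v ⊕ y ⊙ a) ℤ.- z) (lineSum-invariant v y)) ⟩
      ∑ (λ y → + q ℤ.* f (v ⊕ y ⊙ a) ℤ.- lineSum a f v)              ≡⟨ ∑-+ _ _ ⟩
      ∑ (λ y → + q ℤ.* f (v ⊕ y ⊙ a)) ℤ.+ ∑ (λ (y : K) → ℤ.- lineSum a f v)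
        ≡⟨ cong₂ ℤ._+_ (sym (*-∑ (+ q) (λ y → f (v ⊕ y ⊙ a)))) (∑-const (ℤ.- lineSum a f v)) ⟩
      + q ℤ.* lineSum a f v ℤ.+ + q ℤ.* (ℤ.- lineSum a f v)          ≡⟨ cancel (+ q) (lineSum a f v) ⟩
      + 0                                                            ∎
      where
      open ≡-Reasoning
      cancel : ∀ a b → a ℤ.* b ℤ.+ a ℤ.* (ℤ.- b) ≡ + 0
      cancel = solve-∀

    -- With P the line sum, one factor of P² is expanded. As P is constant along `a`, each of the
    -- `q` shifts gives the same inner product of `f` and P.
    norm²-lineSum : norm² (lineSum a f) ≡ + q ℤ.* ∑ (λ v → f v ℤ.* lineSum a f v)
    norm²-lineSum = begin
      ∑ (λ v → P v ℤ.* P v)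
        ≡⟨ ∑-cong (λ v → trans (*-∑ (P v) _) (∑-cong (λ y → trans (ℤₚ.*-comm (P v) (f (v ⊕ y ⊙ a))) (cong (ℤ._*_ (f (v ⊕ y ⊙ a))) (sym (lineSum-invariant v y)))))) ⟩
      ∑ (λ v → ∑ (λ y → f (v ⊕ y ⊙ a) ℤ.* P (v ⊕ y ⊙ a)))        ≡⟨ ∑-swap _ ⟩
      ∑ (λ y → ∑ (λ v → f (v ⊕ y ⊙ a) ℤ.* P (v ⊕ y ⊙ a)))
        ≡⟨ ∑-cong (λ y → ∑-translate (y ⊙ a) (λ v → f v ℤ.* P v)) ⟩
      ∑ (λ (y : K) → ∑ (λ v → f v ℤ.* P v))                      ≡⟨ ∑-const _ ⟩
      + q ℤ.* ∑ (λ v → f v ℤ.* P v)                              ∎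
      where
      open ≡-Reasoning
      P = lineSum a f

    -- Pythagoras: `lineSum a f` is `q` times the orthogonal projection of `f` onto the functions
    -- invariant in direction `a`, and `remainder` is `q` times the complementary part.
    norm²-decompose : norm² remainder ℤ.+ norm² (lineSum a f) ≡ + q ℤ.* + q ℤ.* norm² f
    norm²-decompose = begin
      norm² remainder ℤ.+ norm² P
        ≡⟨ ∑-+ _ _ ⟨
      ∑ (λ v → remainder v ℤ.* remainder v ℤ.+ P v ℤ.* P v)
        ≡⟨ ∑-cong (λ v → square (+ q) (f v) (P v)) ⟩
      ∑ (λ v → + q ℤ.* + q ℤ.* (f v ℤ.* f v) ℤ.+ (+ 2 ℤ.* (P v ℤ.* P v) ℤ.+ ℤ.- (+ 2 ℤ.* + q) ℤ.* (f v ℤ.* P v)))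
        ≡⟨ trans (∑-+ _ _) (cong₂ ℤ._+_ (sym (*-∑ (+ q ℤ.* + q) _)) (trans (∑-+ _ _) (cong₂ ℤ._+_ (sym (*-∑ (+ 2) _)) (sym (*-∑ (ℤ.- (+ 2 ℤ.* + q)) _))))) ⟩
      + q ℤ.* + q ℤ.* norm² f ℤ.+ (+ 2 ℤ.* norm² P ℤ.+ ℤ.- (+ 2 ℤ.* + q) ℤ.* ∑ (λ v → f v ℤ.* P v))
        ≡⟨ cong (λ z → + q ℤ.* + q ℤ.* norm² f ℤ.+ (+ 2 ℤ.* z ℤ.+ ℤ.- (+ 2 ℤ.* + q) ℤ.* ∑ (λ v → f v ℤ.* P v))) norm²-lineSum ⟩
      + q ℤ.* + q ℤ.* norm² f ℤ.+ (+ 2 ℤ.* (+ q ℤ.* ∑ (λ v → f v ℤ.* P v)) ℤ.+ ℤ.- (+ 2 ℤ.* + q) ℤ.* ∑ (λ v → f v ℤ.* P v))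
        ≡⟨ cancel (+ q) (norm² f) (∑ (λ v → f v ℤ.* P v)) ⟩
      + q ℤ.* + q ℤ.* norm² f ∎
      where
      open ≡-Reasoning
      P = lineSum a f
      square : ∀ q f p → (q ℤ.* f ℤ.- p) ℤ.* (q ℤ.* f ℤ.- p) ℤ.+ p ℤ.* p
        ≡ q ℤ.* q ℤ.* (f ℤ.* f) ℤ.+ (+ 2 ℤ.* (p ℤ.* p) ℤ.+ ℤ.- (+ 2 ℤ.* q) ℤ.* (f ℤ.* p))
      square = solve-∀
      cancel : ∀ q f s → q ℤ.* q ℤ.* f ℤ.+ (+ 2 ℤ.* (q ℤ.* s) ℤ.+ ℤ.- (+ 2 ℤ.* q) ℤ.* s) ≡ q ℤ.* q ℤ.* f
      cancel = solve-∀

  -- Convolutions and directions of invariance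

  Invariant : ∀ {n} → Vec K n → (Vec K n → ℤ) → Set
  Invariant a f = ∀ v y → f (v ⊕ y ⊙ a) ≡ f v

  module _ {n} (a : Vec K n) (κ : K → K) where

    convolve-+ : ∀ f g v → convolve a κ (λ v → f v ℤ.+ g v) v ≡ convolve a κ f v ℤ.+ convolve a κ g v
    convolve-+ f g v = ∑-+ (λ x → f (v ⊕ κ x ⊙ a)) (λ x → g (v ⊕ κ x ⊙ a))

    convolve-* : ∀ c f v → convolve a κ (λ v → c ℤ.* f v) v ≡ c ℤ.* convolve a κ f v
    convolve-* c f v = sym (*-∑ c (λ x → f (v ⊕ κ x ⊙ a)))

    ∑-convolve : ∀ f → ∑ (convolve a κ f) ≡ + q ℤ.* ∑ f
    ∑-convolve f = begin
      ∑ (λ v → ∑ (λ x → f (v ⊕ κ x ⊙ a)))   ≡⟨ ∑-swap _ ⟩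
      ∑ (λ x → ∑ (λ v → f (v ⊕ κ x ⊙ a)))   ≡⟨ ∑-cong (λ x → ∑-translate (κ x ⊙ a) f) ⟩
      ∑ (λ (x : K) → ∑ f)                   ≡⟨ ∑-const (∑ f) ⟩
      + q ℤ.* ∑ f                           ∎
      where open ≡-Reasoning

    convolve-invariant : ∀ {b f} → Invariant b f → Invariant b (convolve a κ f)
    convolve-invariant {b} {f} inv v y = ∑-cong (λ x → trans (cong f (⊕-swap v (y ⊙ b) (κ x ⊙ a))) (inv (v ⊕ κ x ⊙ a) y))

    convolve-of-invariant : ∀ {f} → Invariant a f → ∀ v → convolve a κ f v ≡ + q ℤ.* f v
    convolve-of-invariant {f} inv v = trans (∑-cong (λ x → inv v (κ x))) (∑-const (f v))

  -- Removing the columns one by one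

  module _ {n t : ℕ} (col : Fin t → Vec K n) (d : Fin t → ℕ) where

    combination : (is : List (Fin t)) → Vec K (List.length is) → Vec K n
    combination []       []       = 𝟎
    combination (i ∷ is) (c ∷ cs) = c ⊙ col i ⊕ combination is cs

    -- The new term stands on the right, where the convolution `M i` adds it, so that the two agree
    -- by computation in `total≢0`.
    powerSum : (is : List (Fin t)) → Vec K (List.length is) → Vec K n
    powerSum []       []       = 𝟎
    powerSum (i ∷ is) (x ∷ xs) = powerSum is xs ⊕ (x ^ d i) ⊙ col i

    M : Fin t → (Vec K n → ℤ) → Vec K n → ℤ
    M i = convolve (col i) (_^ d i)

    -- The sum of f (powerSum is x) over all x.
    total : List (Fin t) → (Vec K n → ℤ) → ℤ
    total []       f = f 𝟎
    total (i ∷ is) f = total is (M i f)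

    total-cong : ∀ is {f g} → (∀ v → f v ≡ g v) → total is f ≡ total is g
    total-cong []       e = e 𝟎
    total-cong (i ∷ is) e = total-cong is (λ v → ∑-cong (λ x → e _))

    total-+ : ∀ is f g → total is (λ v → f v ℤ.+ g v) ≡ total is f ℤ.+ total is g
    total-+ []       f g = refl
    total-+ (i ∷ is) f g = trans (total-cong is (convolve-+ (col i) (_^ d i) f g)) (total-+ is _ _)

    total-* : ∀ is c f → total is (λ v → c ℤ.* f v) ≡ c ℤ.* total is f
    total-* []       c f = refl
    total-* (i ∷ is) c f = trans (total-cong is (convolve-* (col i) (_^ d i) c f)) (total-* is c _)

    total-0 : ∀ is {f} → (∀ v → f v ≡ + 0) → total is f ≡ + 0
    total-0 is {f} f≡0 = trans (total-cong is (λ v → trans (f≡0 v) (sym (ℤₚ.*-zeroˡ (f v))))) (trans (total-* is (+ 0) f) (ℤₚ.*-zeroˡ (total is f)))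

    total-const : ∀ is c → total is (λ _ → c) ≡ + (q ℕ.^ List.length is) ℤ.* c
    total-const []       c = sym (ℤₚ.*-identityˡ c)
    total-const (i ∷ is) c = begin
      total is (λ _ → ∑ (λ (x : K) → c))                     ≡⟨ total-cong is (λ _ → ∑-const c) ⟩
      total is (λ _ → + q ℤ.* c)                             ≡⟨ total-const is (+ q ℤ.* c) ⟩
      + (q ℕ.^ List.length is) ℤ.* (+ q ℤ.* c)               ≡⟨ rearrange (+ (q ℕ.^ List.length is)) (+ q) c ⟩
      + q ℤ.* + (q ℕ.^ List.length is) ℤ.* c
        ≡⟨ cong (ℤ._* c) (sym (ℤₚ.pos-* q (q ℕ.^ List.length is))) ⟩
      + (q ℕ.* q ℕ.^ List.length is) ℤ.* c                   ∎
      where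
      open ≡-Reasoning
      rearrange : ∀ a b c → a ℤ.* (b ℤ.* c) ≡ b ℤ.* a ℤ.* c
      rearrange = solve-∀

    -- A nonzero sum has a nonzero term; the coordinates are found one by one, starting from the end
    -- of the list.
    total≢0 : ∀ is f → total is f ≢ + 0 → ∃ λ xs → f (powerSum is xs) ≢ + 0
    total≢0 []       f ne = [] , ne
    total≢0 (i ∷ is) f ne =
      let xs , Mf≢0 = total≢0 is (M i f) ne
          x , fx≢0 = ∑-≢0 _ Mf≢0
      in x ∷ xs , fx≢0

    combination-invariant : ∀ is {f} → All (λ i → Invariant (col i) f) is → ∀ c v → f (v ⊕ combination is c) ≡ f v
    combination-invariant []       {f} []           []       v = cong f (⊕-identityʳ v)
    combination-invariant (i ∷ is) {f} (inv ∷ invs) (c ∷ cs) v =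
      trans (cong f (sym (⊕-assoc v (c ⊙ col i) (combination is cs)))) (trans (combination-invariant is invs cs (v ⊕ c ⊙ col i)) (inv v c))

    module _ (1≤d : ∀ i → 1 ≤ d i) (C : ℕ) (d≤C : ∀ i → 2 ℕ.+ 2 ℕ.* (suc (d i) ℕ.* d i) ≤ C)
      (independent : ∀ is → is ⊆ List.allFin t → List.length is ≤ n → Injective _≡_ _≡_ (combination is)) where

      -- By induction on the columns still to be removed; zs lists the directions in which f is already invariant.
      total²≤ : ∀ is zs → zs List.++ is ⊆ List.allFin t → List.length zs ≤ n →
        ∀ f → All (λ i → Invariant (col i) f) zs → ∑ f ≡ + 0 →
        + (q ℕ.^ List.length zs) ℤ.* (total is f ℤ.* total is f) ℤ.≤ + (q ℕ.^ List.length is ℕ.* C ℕ.^ List.length is) ℤ.* norm² f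
      -- No columns remain. `f` is constant on the span of the directions `zs`, which by
      -- independence consists of q^m distinct points, m being the length of `zs`; each of them
      -- contributes the square of `f 𝟎` to the norm.
      total²≤ [] zs zs⊆ zs≤n f inv ∑f≡0 = begin
        + (q ℕ.^ List.length zs) ℤ.* (f 𝟎 ℤ.* f 𝟎)             ≡⟨ ∑-const {Vec K (List.length zs)} (f 𝟎 ℤ.* f 𝟎) ⟨
        ∑ (λ (c : Vec K (List.length zs)) → f 𝟎 ℤ.* f 𝟎)       ≡⟨ ∑-cong (λ c → cong₂ ℤ._*_ (f≡f𝟎 c) (f≡f𝟎 c)) ⟨
        ∑ (λ c → f (combination zs c) ℤ.* f (combination zs c))
          ≤⟨ ∑-injective-≤ (independent zs (subst (_⊆ List.allFin t) (++-identityʳ zs) zs⊆) zs≤n) (λ v → f v ℤ.* f v) (λ v → 0≤i*i (f v)) ⟩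
        norm² f                                                ≡⟨ ℤₚ.*-identityˡ (norm² f) ⟨
        + 1 ℤ.* norm² f                                        ∎
        where
        open ℤₚ.≤-Reasoning
        f≡f𝟎 : ∀ c → f (combination zs c) ≡ f 𝟎
        f≡f𝟎 c = trans (cong f (sym (⊕-identityˡ _))) (combination-invariant zs inv c 𝟎)
      total²≤ (i ∷ is) zs zs⊆ zs≤n f inv ∑f≡0 with List.length zs ℕₚ.≟ n
      -- `n` independent directions fill the whole space, so `f` is constant; its sum being zero, it
      -- vanishes, and so does the left-hand side.
      ... | yes zs≡n = subst (ℤ._≤ _) (sym (trans (cong (λ z → + (q ℕ.^ List.length zs) ℤ.* (z ℤ.* z)) (total-0 (i ∷ is) f≡0)) (ℤₚ.*-zeroʳ (+ (q ℕ.^ List.length zs)))))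
          (subst (ℤ._≤ + B ℤ.* norm² f) (ℤₚ.*-zeroʳ (+ B)) (*-mono-≤-pos B (norm²≥0 f)))
        where
        B = q ℕ.^ suc (List.length is) ℕ.* C ℕ.^ suc (List.length is)
        onto : ∀ {m} (g : Vec K m → Vec K n) → m ≡ n → Injective _≡_ _≡_ g → ∀ v → ∃ λ c → g c ≡ v
        onto g refl inj = injective⇒surjective inj
        zs⊆all : zs ⊆ List.allFin t
        zs⊆all = ⊆-trans (++⁺ʳ (i ∷ is) ⊆-refl) zs⊆
        f≡f𝟎 : ∀ v → f v ≡ f 𝟎
        f≡f𝟎 v = let c , e = onto (combination zs) zs≡n (independent zs zs⊆all zs≤n) v in
          trans (cong f (trans (sym e) (sym (⊕-identityˡ _)))) (combination-invariant zs inv c 𝟎)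
        f𝟎≡0 : f 𝟎 ≡ + 0
        f𝟎≡0 = ℤₚ.*-cancelˡ-≡ (+ (q ℕ.^ n)) (f 𝟎) (+ 0) ⦃ ℕₚ.m^n≢0 q n ⦃ ℕ.>-nonZero (ℕₚ.<-trans (s≤s z≤n) 1<q) ⦄ ⦄
          (trans (trans (sym (trans (∑-cong f≡f𝟎) (∑-const {Vec K n} (f 𝟎)))) ∑f≡0) (sym (ℤₚ.*-zeroʳ (+ (q ℕ.^ n)))))
        f≡0 : ∀ v → f v ≡ + 0
        f≡0 v = trans (f≡f𝟎 v) f𝟎≡0
      -- Here x = q^m, y = q^s C^s and e = (d_i + 1) d_i. The line sums are invariant in the
      -- additional direction `i`, so the inductive hypothesis for them carries the factor q^(m +
      -- 1). The remainder keeps its `m` directions, and `powerSum-norm²` controls its image under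
      -- `M i`.
      ... | no zs≢n = subst (λ b → + (q ℕ.^ m) ℤ.* (total (i ∷ is) f ℤ.* total (i ∷ is) f) ℤ.≤ + b ℤ.* norm² f) (rearrange q (q ℕ.^ s) C (C ℕ.^ s))
          (step-inequality q (q ℕ.^ m) (q ℕ.^ s ℕ.* C ℕ.^ s) (suc (d i) ℕ.* d i) C ⦃ ℕ.>-nonZero (ℕₚ.<-trans (s≤s z≤n) 1<q) ⦄
            (norm² f) (total (i ∷ is) f) (total is P) (total is MR) (norm² P) (norm² MR) (norm² R) (norm²≥0 f) (d≤C i) split
            (subst (λ k → + (q ℕ.^ k) ℤ.* (total is P ℤ.* total is P) ℤ.≤ + (q ℕ.^ s ℕ.* C ℕ.^ s) ℤ.* norm² P) m+1
              (total²≤ is (zs List.∷ʳ i) (subst (_⊆ List.allFin t) (sym (++-assoc zs (i ∷ []) is)) zs⊆) (subst (_≤ n) (sym m+1) (ℕₚ.≤∧≢⇒< zs≤n zs≢n))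
                P (∷ʳ⁺ (All.map (convolve-invariant a (λ x → x)) inv) (lineSum-invariant a f)) ∑P≡0))
            (part≤ʳ (norm²≥0 R) (norm²-decompose a f))
            (total²≤ is zs (⊆-trans (++⁺ ⊆-refl (i ∷ʳ ⊆-refl)) zs⊆) zs≤n MR
              (All.map (λ inv′ → convolve-invariant a (_^ d i) (remainder-invariant inv′)) inv) ∑MR≡0)
            (powerSum-norm² a (d i) (1≤d i) R (remainder-lineSum a f))
            (part≤ˡ (norm²≥0 P) (norm²-decompose a f)))
        where
        a = col i
        m = List.length zs
        s = List.length is
        P = lineSum a f
        R = remainder a f
        MR = M i R
        m+1 : List.length (zs List.∷ʳ i) ≡ suc m
        m+1 = trans (length-++ zs) (ℕₚ.+-comm m 1)
        rearrange : ∀ a b c d → a ℕ.* (b ℕ.* d) ℕ.* c ≡ a ℕ.* b ℕ.* (c ℕ.* d)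
        rearrange = ℕSolver.solve-∀
        part≤ˡ : ∀ {x y z} → + 0 ℤ.≤ y → x ℤ.+ y ≡ z → x ℤ.≤ z
        part≤ˡ {x} {y} y≥0 e = subst₂ ℤ._≤_ (ℤₚ.+-identityʳ x) e (ℤₚ.+-monoʳ-≤ x y≥0)
        part≤ʳ : ∀ {x y z} → + 0 ℤ.≤ x → x ℤ.+ y ≡ z → y ℤ.≤ z
        part≤ʳ {x} {y} x≥0 e = subst₂ ℤ._≤_ (ℤₚ.+-identityˡ y) e (ℤₚ.+-monoˡ-≤ y x≥0)
        remainder-invariant : ∀ {b} → Invariant b f → Invariant b R
        remainder-invariant inv′ v y = cong₂ (λ z w → + q ℤ.* z ℤ.- w) (inv′ v y) (convolve-invariant a (λ x → x) inv′ v y)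
        ∑P≡0 : ∑ P ≡ + 0
        ∑P≡0 = trans (∑-convolve a (λ x → x) f) (trans (cong (ℤ._*_ (+ q)) ∑f≡0) (ℤₚ.*-zeroʳ (+ q)))
        ∑R≡0 : ∑ R ≡ + 0
        ∑R≡0 = GroupProperties.∙-cancelʳ (AbelianGroup.group ℤₚ.+-0-abelianGroup) (∑ P) (∑ R) (+ 0) (begin
          ∑ R ℤ.+ ∑ P                  ≡⟨ ∑-+ R P ⟨
          ∑ (λ v → R v ℤ.+ P v)        ≡⟨ ∑-cong (λ v → restore (+ q ℤ.* f v) (P v)) ⟩
          ∑ (λ v → + q ℤ.* f v)        ≡⟨ *-∑ (+ q) f ⟨
          + q ℤ.* ∑ f                  ≡⟨ ∑-convolve a (λ x → x) f ⟨
          ∑ P                          ≡⟨ ℤₚ.+-identityˡ (∑ P) ⟨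
          + 0 ℤ.+ ∑ P                  ∎)
          where
          open ≡-Reasoning
          restore : ∀ x y → x ℤ.- y ℤ.+ y ≡ x
          restore = solve-∀
        ∑MR≡0 : ∑ MR ≡ + 0
        ∑MR≡0 = trans (∑-convolve a (_^ d i) R) (trans (cong (ℤ._*_ (+ q)) ∑R≡0) (ℤₚ.*-zeroʳ (+ q)))
        -- q f = P + R, and `M i` acts on the invariant function `P` as multiplication by `q`.
        split : + q ℤ.* total (i ∷ is) f ≡ + q ℤ.* total is P ℤ.+ total is MR
        split = begin
          + q ℤ.* total is (M i f)                                   ≡⟨ total-* is (+ q) (M i f) ⟨
          total is (λ v → + q ℤ.* M i f v)                           ≡⟨ total-cong is pointwise ⟩
          total is (λ v → + q ℤ.* P v ℤ.+ MR v)                      ≡⟨ total-+ is (λ v → + q ℤ.* P v) MR ⟩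
          total is (λ v → + q ℤ.* P v) ℤ.+ total is MR               ≡⟨ cong (ℤ._+ total is MR) (total-* is (+ q) P) ⟩
          + q ℤ.* total is P ℤ.+ total is MR                         ∎
          where
          open ≡-Reasoning
          swap : ∀ x y → x ≡ y ℤ.+ (x ℤ.- y)
          swap = solve-∀
          pointwise : ∀ v → + q ℤ.* M i f v ≡ + q ℤ.* P v ℤ.+ MR v
          pointwise v = begin
            + q ℤ.* M i f v                          ≡⟨ convolve-* a (_^ d i) (+ q) f v ⟨
            M i (λ v → + q ℤ.* f v) v
              ≡⟨ ∑-cong (λ x → swap (+ q ℤ.* f (v ⊕ (x ^ d i) ⊙ a)) (P (v ⊕ (x ^ d i) ⊙ a))) ⟩
            M i (λ v → P v ℤ.+ R v) v                ≡⟨ convolve-+ a (_^ d i) P R v ⟩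
            M i P v ℤ.+ MR v
              ≡⟨ cong (ℤ._+ MR v) (convolve-of-invariant a (_^ d i) (lineSum-invariant a f) v) ⟩
            + q ℤ.* P v ℤ.+ MR v                     ∎

  -- Linear independence of columns

  sum-↑ : ∀ k {s} (f : Fin (k ℕ.+ s) → K) → KSum.sum f ≡ KSum.sum (λ l → f (l Fin.↑ˡ s)) + KSum.sum (λ l → f (k Fin.↑ʳ l))
  sum-↑ zero    f = sym (+-identityˡ _)
  sum-↑ (suc k) f = trans (cong (_+_ (f zero)) (sum-↑ k (f ∘ suc))) (sym (+-assoc _ _ _))

  δ : ∀ {m} → Fin m → Fin m → K
  δ i j with i Finₚ.≟ j
  ... | yes _ = 1#
  ... | no  _ = 0#

  δ-refl : ∀ {m} (i : Fin m) → δ i i ≡ 1#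
  δ-refl i with i Finₚ.≟ i
  ... | yes _ = refl
  ... | no ne = contradiction refl ne

  δ-≢ : ∀ {m} {i j : Fin m} → i ≢ j → δ i j ≡ 0#
  δ-≢ {i = i} {j} i≢j with i Finₚ.≟ j
  ... | yes e = contradiction e i≢j
  ... | no  _ = refl

  sum-δ : ∀ {m} i (w : Fin m → K) → KSum.sum (λ j → δ j i * w j) ≡ w i
  sum-δ i w = trans (sum-single +-commutativeMonoid (λ j → δ j i * w j) i (λ j j≢i → trans (cong (_* w j) (δ-≢ j≢i)) (zeroˡ (w j))))
    (trans (cong (_* w i) (δ-refl i)) (*-identityˡ (w i)))

  module _ {n m} (A : Fin n → Fin m → K) where

    -- If `σ i` and `σ j` agree for `i ≢ j`, the difference of the two unit vectors is a nontrivial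
    -- relation between the columns.
    independent⇒injective : ∀ {r} (σ : Fin r → Fin m) → Independent (λ j l → A j (σ l)) → Injective _≡_ _≡_ σ
    independent⇒injective σ ind {i} {j} σi≡σj with i Finₚ.≟ j
    ... | yes e = e
    ... | no i≢j = contradiction (trans (sym coefficient) (ind y y-dependent i)) 1≢0
      where
      y : Fin _ → K
      y l = δ l i + δ l j * - 1#
      coefficient : y i ≡ 1#
      coefficient = trans (cong₂ (λ a b → a + b * - 1#) (δ-refl i) (δ-≢ i≢j)) (trans (cong (_+_ 1#) (zeroˡ (- 1#))) (+-identityʳ 1#))
      y-dependent : ∀ r → KSum.sum (λ l → y l * A r (σ l)) ≡ 0#
      y-dependent r = begin
        KSum.sum (λ l → y l * A r (σ l))
          ≡⟨ KSum.sum-cong-≗ (λ l → trans (distribʳ (A r (σ l)) (δ l i) (δ l j * - 1#)) (cong (_+_ (δ l i * A r (σ l))) (*-assoc (δ l j) (- 1#) (A r (σ l))))) ⟩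
        KSum.sum (λ l → δ l i * A r (σ l) + δ l j * (- 1# * A r (σ l)))
          ≡⟨ KSum.∑-distrib-+ (λ l → δ l i * A r (σ l)) (λ l → δ l j * (- 1# * A r (σ l))) ⟩
        KSum.sum (λ l → δ l i * A r (σ l)) + KSum.sum (λ l → δ l j * (- 1# * A r (σ l)))
          ≡⟨ cong₂ _+_ (sum-δ i (λ l → A r (σ l))) (sum-δ j (λ l → - 1# * A r (σ l))) ⟩
        A r (σ i) + - 1# * A r (σ j)
          ≡⟨ cong₂ (λ a b → a + - 1# * A r b) (sym (*-identityˡ (A r (σ i)))) (sym σi≡σj) ⟩
        1# * A r (σ i) + - 1# * A r (σ i)
          ≡⟨ distribʳ (A r (σ i)) 1# (- 1#) ⟨
        (1# + - 1#) * A r (σ i)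
          ≡⟨ trans (cong (_* A r (σ i)) (-‿inverseʳ 1#)) (zeroˡ (A r (σ i))) ⟩
        0# ∎
        where open ≡-Reasoning

    -- Independence forces `π` to be injective, hence a permutation of the `r` columns, and a linear
    -- relation can be permuted. This removes the arbitrary choice of columns contained in the
    -- notion of rank.
    independent-reorder : ∀ {r} (σ : Fin r → Fin m) (π : Fin r → Fin r) →
      Independent (λ j l → A j (σ (π l))) → Independent (λ j l → A j (σ l))
    independent-reorder {r} σ π ind y Ay≡0 l = trans (cong y (sym e)) (ind (y ∘ π) Ayπ≡0 l′)
      where
      π-injective : Injective _≡_ _≡_ π
      π-injective e = independent⇒injective (σ ∘ π) ind (cong σ e)
      l′ = proj₁ (Fin-injective⇒surjective π-injective l)
      e = proj₂ (Fin-injective⇒surjective π-injective l)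
      Ayπ≡0 : ∀ j → KSum.sum (λ l → y (π l) * A j (σ (π l))) ≡ 0#
      Ayπ≡0 j = trans (sym (KSum.sum-permute (λ l → y l * A j (σ l)) (Fin-injective⇒permutation π-injective))) (Ay≡0 j)

  module _ {n t} (A : Fin n → Fin t → K) (d : Fin t → ℕ) where

    column : Fin t → Vec K n
    column i = Vec.tabulate (λ j → A j i)

    lookup-combination : ∀ is c j → lookup (combination column d is c) j ≡ KSum.sum (λ l → lookup c l * A j (List.lookup is l))
    lookup-combination []       []       j = Vecₚ.lookup-replicate j 0#
    lookup-combination (i ∷ is) (c ∷ cs) j = trans (Vecₚ.lookup-zipWith _+_ j (c ⊙ column i) (combination column d is cs))
      (cong₂ _+_ (trans (Vecₚ.lookup-map j (c *_) (column i)) (cong (c *_) (Vecₚ.lookup∘tabulate (λ j → A j i) j))) (lookup-combination is cs j))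

    combination-injective : ∀ is → Independent (λ j l → A j (List.lookup is l)) → Injective _≡_ _≡_ (combination column d is)
    combination-injective is ind {c} {c′} e = lookup-ext (λ l → x∙y⁻¹≈ε⇒x≈y (lookup c l) (lookup c′ l) (ind y Ay≡0 l))
      where
      y : Fin (List.length is) → K
      y l = lookup c l + - lookup c′ l
      a : ∀ j → Fin (List.length is) → K
      a j l = A j (List.lookup is l)
      Ay≡0 : ∀ j → KSum.sum (λ l → y l * a j l) ≡ 0#
      Ay≡0 j = ∙-cancelʳ (KSum.sum (λ l → lookup c′ l * a j l)) _ _ (begin
        KSum.sum (λ l → y l * a j l) + KSum.sum (λ l → lookup c′ l * a j l)
          ≡⟨ KSum.∑-distrib-+ (λ l → y l * a j l) (λ l → lookup c′ l * a j l) ⟨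
        KSum.sum (λ l → y l * a j l + lookup c′ l * a j l)
          ≡⟨ KSum.sum-cong-≗ (λ l → trans (sym (distribʳ (a j l) (y l) (lookup c′ l))) (cong (_* a j l) (cancel (lookup c l) (lookup c′ l)))) ⟩
        KSum.sum (λ l → lookup c l * a j l)                                   ≡⟨ lookup-combination is c j ⟨
        lookup (combination column d is c) j                                  ≡⟨ cong (λ v → lookup v j) e ⟩
        lookup (combination column d is c′) j                                 ≡⟨ lookup-combination is c′ j ⟩
        KSum.sum (λ l → lookup c′ l * a j l)                                  ≡⟨ +-identityˡ _ ⟨
        0# + KSum.sum (λ l → lookup c′ l * a j l)                             ∎)
        where
        open ≡-Reasoning
        cancel : ∀ a b → a + - b + b ≡ a
        cancel a b = trans (+-assoc a (- b) b) (trans (cong (_+_ a) (-‿inverseˡ b)) (+-identityʳ a))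

    pad : ∀ {is zs : List (Fin t)} → is ⊆ zs → Vec K (List.length is) → Vec K (List.length zs)
    pad []         []       = []
    pad (_ ∷ʳ p)   cs       = 0# ∷ pad p cs
    pad (refl ∷ p) (c ∷ cs) = c ∷ pad p cs

    pad-injective : ∀ {is zs} (p : is ⊆ zs) → Injective _≡_ _≡_ (pad p)
    pad-injective []         {[]}    {[]}    _ = refl
    pad-injective (_ ∷ʳ p)   e = pad-injective p (Vecₚ.∷-injectiveʳ e)
    pad-injective (refl ∷ p) {_ ∷ _} {_ ∷ _} e = cong₂ _∷_ (Vecₚ.∷-injectiveˡ e) (pad-injective p (Vecₚ.∷-injectiveʳ e))

    combination-pad : ∀ {is zs} (p : is ⊆ zs) c → combination column d zs (pad p c) ≡ combination column d is c
    combination-pad []         []       = refl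
    combination-pad (z ∷ʳ p)   cs       = trans (cong₂ _⊕_ (0⊙ (column z)) (combination-pad p cs)) (⊕-identityˡ _)
    combination-pad (refl ∷ p) (c ∷ cs) = cong (_⊕_ (c ⊙ column _)) (combination-pad p cs)

    -- Coefficients of the smaller family are padded with zeros to coefficients of the larger one.
    combination-injective-⊆ : ∀ {is zs} → is ⊆ zs → Injective _≡_ _≡_ (combination column d zs) → Injective _≡_ _≡_ (combination column d is)
    combination-injective-⊆ p inj {c} {c′} e = pad-injective p (inj (trans (combination-pad p c) (trans e (sym (combination-pad p c′)))))

    -- For a variable `m` the length of `List.tabulate g` does not compute to `m`, so the vector is
    -- built by the recursion that builds the list.
    coefficients : ∀ {m} (g : Fin m → Fin t) → (Fin m → K) → Vec K (List.length (List.tabulate g))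
    coefficients {zero}  g y = []
    coefficients {suc m} g y = y zero ∷ coefficients (g ∘ suc) (y ∘ suc)

    coefficients-injective : ∀ {m} (g : Fin m → Fin t) {y y′} → coefficients g y ≡ coefficients g y′ → ∀ l → y l ≡ y′ l
    coefficients-injective g e zero    = Vecₚ.∷-injectiveˡ e
    coefficients-injective g e (suc l) = coefficients-injective (g ∘ suc) (Vecₚ.∷-injectiveʳ e) l

    combination-coefficients : ∀ {m} (g : Fin m → Fin t) y j →
      lookup (combination column d (List.tabulate g) (coefficients g y)) j ≡ KSum.sum (λ l → y l * A j (g l))
    combination-coefficients {zero}  g y j = Vecₚ.lookup-replicate j 0#
    combination-coefficients {suc m} g y j = trans (Vecₚ.lookup-zipWith _+_ j (y zero ⊙ column (g zero)) _)
      (cong₂ _+_ (trans (Vecₚ.lookup-map j (y zero *_) (column (g zero))) (cong (y zero *_) (Vecₚ.lookup∘tabulate (λ j → A j (g zero)) j)))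
        (combination-coefficients (g ∘ suc) (y ∘ suc) j))

    combination-injective⇒independent : ∀ {m} (g : Fin m → Fin t) →
      Injective _≡_ _≡_ (combination column d (List.tabulate g)) → Independent (λ j l → A j (g l))
    combination-injective⇒independent {m} g inj y Ay≡0 = coefficients-injective g (inj (lookup-ext (λ j → begin
      lookup (combination column d (List.tabulate g) (coefficients g y)) j
        ≡⟨ combination-coefficients g y j ⟩
      KSum.sum (λ l → y l * A j (g l))                                                ≡⟨ Ay≡0 j ⟩
      0#                                                                              ≡⟨ KSum.sum-replicate-zero m ⟨
      KSum.sum {m} (λ l → 0#)
        ≡⟨ KSum.sum-cong-≗ (λ l → sym (zeroˡ (A j (g l)))) ⟩
      KSum.sum (λ l → 0# * A j (g l))
        ≡⟨ combination-coefficients g (λ _ → 0#) j ⟨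
      lookup (combination column d (List.tabulate g) (coefficients g (λ _ → 0#))) j   ∎)))
      where open ≡-Reasoning

    powerSum-tabulate : ∀ {m} (g : Fin m → Fin t) xs → ∃ λ (x : Fin m → K) →
      ∀ j → lookup (powerSum column d (List.tabulate g) xs) j ≡ KSum.sum (λ l → A j (g l) * x l ^ d (g l))
    powerSum-tabulate {zero}  g []       = (λ ()) , λ j → Vecₚ.lookup-replicate j 0#
    powerSum-tabulate {suc m} g (x ∷ xs) = let y , e = powerSum-tabulate (g ∘ suc) xs in
      x VF.∷ y , λ j → trans (Vecₚ.lookup-zipWith _+_ j (powerSum column d (List.tabulate (g ∘ suc)) xs) ((x ^ d (g zero)) ⊙ column (g zero)))
        (trans (+-comm _ _) (cong₂ _+_ (trans (Vecₚ.lookup-map j (x ^ d (g zero) *_) (column (g zero)))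
          (trans (cong (x ^ d (g zero) *_) (Vecₚ.lookup∘tabulate (λ j → A j (g zero)) j)) (*-comm (x ^ d (g zero)) (A j (g zero))))) (e j)))

    -- The list is completed to `n` columns. A sublist of `allFin t` is increasing, so its entries
    -- form a strictly monotone selection, to which (H) applies; independence then passes to the
    -- original sublist.
    subfamilies-injective : n ≤ t →
      (∀ (σ : Fin n → Fin t) → Monotonic₁ Fin._<_ Fin._<_ σ → ∃ λ (π : Fin n → Fin n) → Independent (λ j l → A j (σ (π l)))) →
      ∀ is → is ⊆ List.allFin t → List.length is ≤ n → Injective _≡_ _≡_ (combination column d is)
    subfamilies-injective n≤t full is is⊆ is≤n =
      let zs , is⊆zs , zs⊆ , zs≡n = extend-⊆ is⊆ n is≤n (subst (n ≤_) (sym (length-tabulate {n = t} (λ i → i))) n≤t)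
      in combination-injective-⊆ is⊆zs (combination-injective zs (subst Full (sym zs≡n) full′ (List.lookup zs)
           (AllPairs-lookup (AllPairs-resp-⊆ zs⊆ (tabulate⁺-< (λ i<j → i<j))))))
      where
      Full : ℕ → Set
      Full r = ∀ (σ : Fin r → Fin t) → Monotonic₁ Fin._<_ Fin._<_ σ → Independent (λ j l → A j (σ l))
      full′ : Full n
      full′ σ mono = let π , ind = full σ mono in independent-reorder A σ π ind

  -- Existence of a solution over `Fin q`

  module _ {n k s} (A : Fin n → Fin (k ℕ.+ s) → K)
    (full : ∀ (σ : Fin n → Fin (k ℕ.+ s)) → Monotonic₁ Fin._<_ Fin._<_ σ → ∃ λ (π : Fin n → Fin n) → Independent (λ j l → A j (σ (π l))))
    (k≤n : k ≤ n) (2n≤t : 2 ℕ.* n ≤ k ℕ.+ s)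
    (d : Fin (k ℕ.+ s) → ℕ) {ε D} (1≤ε : 1 ≤ ε) (ε≤d : ∀ i → ε ≤ d i) (d≤D : ∀ i → d i ≤ D)
    (G : Fin n → Vec K k → K) (low : ∀ j → DegreeBelow ε (G j))
    (C : ℕ) (d≤C : ∀ i → 2 ℕ.+ 2 ℕ.* (suc (d i) ℕ.* d i) ≤ C)
    (large : C ℕ.^ s ℕ.* D ℕ.^ k < q ℕ.^ (k ℕ.+ s ∸ 2 ℕ.* n)) where
    private
      t = k ℕ.+ s
      is = List.tabulate {n = s} (k Fin.↑ʳ_)

      h : Vec K k → Vec K n
      h x = Vec.tabulate (λ j → G j x + - KSum.sum (λ l → A j (l Fin.↑ˡ s) * lookup x l ^ d (l Fin.↑ˡ s)))

      f : Vec K n → ℤ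
      f v = ∑ (λ x → ⟦ h x ≟ v ⟧)

      injective : ∀ is → is ⊆ List.allFin t → List.length is ≤ n → Injective _≡_ _≡_ (combination (column A d) d is)
      injective = subfamilies-injective A d (ℕₚ.≤-trans (ℕₚ.m≤n*m n 2) 2n≤t) full

      length-is : List.length is ≡ s
      length-is = length-tabulate (k Fin.↑ʳ_)

    -- The condition `h x ≡ v` is a system with right-hand sides G_j - v_j, still of degree below
    -- `ε` because `1 ≤ ε`. The first `k ≤ n` columns are independent, so the fibre bound applies.
    f≤ : ∀ v → f v ℤ.≤ + (D ℕ.^ k)
    f≤ v = ∑-count≤ (λ x → h x ≟ v) (D ℕ.^ k) (λ N pts inj on → fibre≤ (λ j l → A j (l Fin.↑ˡ s))
      (combination-injective⇒independent A d (Fin._↑ˡ s) (injective _ (tabulate-↑ˡ-⊆ k s (λ i → i)) (subst (_≤ n) (sym (length-tabulate (Fin._↑ˡ s))) k≤n)))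
      (λ l → d (l Fin.↑ˡ s)) (λ l → ε≤d (l Fin.↑ˡ s)) (λ l → d≤D (l Fin.↑ˡ s)) {G = λ j x → - lookup v j + G j x} low′ pts
      (λ i j → solve-for (trans (sym (Vecₚ.lookup∘tabulate _ j)) (cong (λ u → lookup u j) (on i)))) inj)
      where
      low′ : ∀ j → DegreeBelow ε (λ x → - lookup v j + G j x)
      low′ j = let g , g<ε , e = low j in (- lookup v j , Vec.replicate k 0) ∷ g , subst (_< ε) (sym (sum-replicate-0 k)) 1≤ε ∷ g<ε ,
        λ x → cong₂ _+_ (sym (trans (cong (- lookup v j *_) (monomial-0 x)) (*-identityʳ _))) (e x)
      solve-for : ∀ {a b c} → a + - b ≡ c → b ≡ - c + a
      solve-for {a} {b} {c} e = begin
        b                ≡⟨ +-identityˡ b ⟨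
        0# + b           ≡⟨ cong (_+ b) (-‿inverseˡ c) ⟨
        - c + c + b      ≡⟨ +-assoc (- c) c b ⟩
        - c + (c + b)    ≡⟨ cong (λ z → - c + (z + b)) (sym e) ⟩
        - c + (a + - b + b)
          ≡⟨ cong (_+_ (- c)) (trans (+-assoc a (- b) b) (trans (cong (_+_ a) (-‿inverseˡ b)) (+-identityʳ a))) ⟩
        - c + a          ∎
        where open ≡-Reasoning

    ∑f : ∑ f ≡ + (q ℕ.^ k)
    ∑f = begin
      ∑ f                                             ≡⟨ ∑-cong (λ v → ℤₚ.*-identityˡ (f v)) ⟨
      ∑ (λ v → + 1 ℤ.* f v)                           ≡⟨ ∑-fibres h (λ _ → + 1) ⟨
      ∑ (λ (x : Vec K k) → + 1)                       ≡⟨ trans (∑-const {Vec K k} (+ 1)) (ℤₚ.*-identityʳ _) ⟩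
      + (q ℕ.^ k)                                     ∎
      where open ≡-Reasoning

    -- ‖f‖² counts the pairs of points with equal image under `h`: for each of the q^k points there
    -- are at most D^k partners.
    norm²f≤ : norm² f ℤ.≤ + (q ℕ.^ k ℕ.* D ℕ.^ k)
    norm²f≤ = begin
      norm² f                                   ≡⟨ ∑-fibres h f ⟨
      ∑ (λ x → f (h x))                         ≤⟨ ∑-mono (λ x → f≤ (h x)) ⟩
      ∑ (λ (x : Vec K k) → + (D ℕ.^ k))         ≡⟨ trans (∑-const {Vec K k} _) (sym (ℤₚ.pos-* (q ℕ.^ k) (D ℕ.^ k))) ⟩
      + (q ℕ.^ k ℕ.* D ℕ.^ k)                   ∎
      where open ℤₚ.≤-Reasoning

    private
      N = + (q ℕ.^ n)

      -- q^n times the deviation of `f` from its mean, again scaled to stay within the integers.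
      f₀ : Vec K n → ℤ
      f₀ v = N ℤ.* f v ℤ.+ ℤ.- ∑ f

    ∑f₀ : ∑ f₀ ≡ + 0
    ∑f₀ = begin
      ∑ f₀                                               ≡⟨ ∑-+ _ _ ⟩
      ∑ (λ v → N ℤ.* f v) ℤ.+ ∑ (λ (v : Vec K n) → ℤ.- ∑ f)
        ≡⟨ cong₂ ℤ._+_ (sym (*-∑ N f)) (∑-const {Vec K n} (ℤ.- ∑ f)) ⟩
      N ℤ.* ∑ f ℤ.+ N ℤ.* (ℤ.- ∑ f)                      ≡⟨ cancel N (∑ f) ⟩
      + 0                                                ∎
      where
      open ≡-Reasoning
      cancel : ∀ a b → a ℤ.* b ℤ.+ a ℤ.* (ℤ.- b) ≡ + 0
      cancel = solve-∀

    -- The variance is at most the second moment: the exact difference of the two sides is q^n (∑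
    -- f)².
    norm²f₀≤ : norm² f₀ ℤ.≤ N ℤ.* N ℤ.* norm² f
    norm²f₀≤ = begin
      norm² f₀
        ≡⟨ ∑-cong (λ v → square N (f v) (∑ f)) ⟩
      ∑ (λ v → N ℤ.* N ℤ.* (f v ℤ.* f v) ℤ.+ (ℤ.- (+ 2 ℤ.* N ℤ.* ∑ f) ℤ.* f v ℤ.+ ∑ f ℤ.* ∑ f))
        ≡⟨ trans (∑-+ _ _) (cong₂ ℤ._+_ (sym (*-∑ (N ℤ.* N) _)) (trans (∑-+ _ _) (cong₂ ℤ._+_ (sym (*-∑ (ℤ.- (+ 2 ℤ.* N ℤ.* ∑ f)) f)) (∑-const {Vec K n} (∑ f ℤ.* ∑ f))))) ⟩
      N ℤ.* N ℤ.* norm² f ℤ.+ (ℤ.- (+ 2 ℤ.* N ℤ.* ∑ f) ℤ.* ∑ f ℤ.+ N ℤ.* (∑ f ℤ.* ∑ f))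
        ≡⟨ collect N (norm² f) (∑ f) ⟩
      N ℤ.* N ℤ.* norm² f ℤ.+ ℤ.- (N ℤ.* (∑ f ℤ.* ∑ f))
        ≤⟨ ℤₚ.+-monoʳ-≤ (N ℤ.* N ℤ.* norm² f) (ℤₚ.neg-mono-≤ (subst (ℤ._≤ N ℤ.* (∑ f ℤ.* ∑ f)) (ℤₚ.*-zeroʳ N) (*-mono-≤-pos (q ℕ.^ n) (0≤i*i (∑ f))))) ⟩
      N ℤ.* N ℤ.* norm² f ℤ.+ + 0
        ≡⟨ ℤₚ.+-identityʳ _ ⟩
      N ℤ.* N ℤ.* norm² f ∎
      where
      open ℤₚ.≤-Reasoning
      square : ∀ N f S → (N ℤ.* f ℤ.+ ℤ.- S) ℤ.* (N ℤ.* f ℤ.+ ℤ.- S) ≡ N ℤ.* N ℤ.* (f ℤ.* f) ℤ.+ (ℤ.- (+ 2 ℤ.* N ℤ.* S) ℤ.* f ℤ.+ S ℤ.* S)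
      square = solve-∀
      collect : ∀ N F S → N ℤ.* N ℤ.* F ℤ.+ (ℤ.- (+ 2 ℤ.* N ℤ.* S) ℤ.* S ℤ.+ N ℤ.* (S ℤ.* S)) ≡ N ℤ.* N ℤ.* F ℤ.+ ℤ.- (N ℤ.* (S ℤ.* S))
      collect = solve-∀

    -- If the sum vanished, the sum for `f₀` would be -q^t, coming from the mean alone. The estimate
    -- `total²≤`, started with no directions of invariance, then gives q^(2t) ≤ q^s C^s q^(2n) q^k
    -- D^k, that is q^(t - 2n) ≤ C^s D^k, against `large`.
    total-f≢0 : total (column A d) d is f ≢ + 0
    total-f≢0 total≡0 = ℕₚ.<⇒≱ large (ℕₚ.*-cancelˡ-≤ (q ℕ.^ (2 ℕ.* n)) ⦃ q^≢0 (2 ℕ.* n) ⦄ (ℕₚ.*-cancelˡ-≤ (q ℕ.^ t) ⦃ q^≢0 t ⦄ (begin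
      q ℕ.^ t ℕ.* (q ℕ.^ (2 ℕ.* n) ℕ.* q ℕ.^ (t ∸ 2 ℕ.* n))
        ≡⟨ cong (q ℕ.^ t ℕ.*_) (trans (sym (ℕₚ.^-distribˡ-+-* q (2 ℕ.* n) (t ∸ 2 ℕ.* n))) (cong (q ℕ.^_) (ℕₚ.m+[n∸m]≡n 2n≤t))) ⟩
      q ℕ.^ t ℕ.* q ℕ.^ t
        ≤⟨ ℤₚ.drop‿+≤+ bound ⟩
      q ℕ.^ s ℕ.* C ℕ.^ s ℕ.* (q ℕ.^ n ℕ.* q ℕ.^ n ℕ.* (q ℕ.^ k ℕ.* D ℕ.^ k))
        ≡⟨ rearrange (q ℕ.^ s) (C ℕ.^ s) (q ℕ.^ n) (q ℕ.^ k) (D ℕ.^ k) ⟩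
      q ℕ.^ k ℕ.* q ℕ.^ s ℕ.* (q ℕ.^ n ℕ.* q ℕ.^ n ℕ.* (C ℕ.^ s ℕ.* D ℕ.^ k))
        ≡⟨ cong₂ (λ a b → a ℕ.* (b ℕ.* (C ℕ.^ s ℕ.* D ℕ.^ k))) (sym (ℕₚ.^-distribˡ-+-* q k s))
             (trans (sym (ℕₚ.^-distribˡ-+-* q n n)) (cong (λ m → q ℕ.^ (n ℕ.+ m)) (sym (ℕₚ.+-identityʳ n)))) ⟩
      q ℕ.^ t ℕ.* (q ℕ.^ (2 ℕ.* n) ℕ.* (C ℕ.^ s ℕ.* D ℕ.^ k)) ∎)))
      where
      open ℕₚ.≤-Reasoning
      q^≢0 : ∀ m → NonZero (q ℕ.^ m)
      q^≢0 m = ℕₚ.m^n≢0 q m ⦃ ℕ.>-nonZero (ℕₚ.<-trans (s≤s z≤n) 1<q) ⦄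
      rearrange : ∀ a b c d e → a ℕ.* b ℕ.* (c ℕ.* c ℕ.* (d ℕ.* e)) ≡ d ℕ.* a ℕ.* (c ℕ.* c ℕ.* (b ℕ.* e))
      rearrange = ℕSolver.solve-∀
      τ = total (column A d) d is
      τf₀ : τ f₀ ≡ ℤ.- + (q ℕ.^ t)
      τf₀ = trans (total-+ (column A d) d is (λ v → N ℤ.* f v) (λ _ → ℤ.- ∑ f)) (trans
        (cong₂ ℤ._+_ (trans (total-* (column A d) d is N f) (trans (cong (ℤ._*_ N) total≡0) (ℤₚ.*-zeroʳ N)))
          (trans (total-const (column A d) d is (ℤ.- ∑ f)) (trans (cong₂ (λ m S → + (q ℕ.^ m) ℤ.* (ℤ.- S)) length-is ∑f)
            (trans (sym (ℤₚ.neg-distribʳ-* (+ (q ℕ.^ s)) (+ (q ℕ.^ k)))) (cong ℤ.-_ (trans (sym (ℤₚ.pos-* (q ℕ.^ s) (q ℕ.^ k)))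
              (cong +_ (trans (ℕₚ.*-comm (q ℕ.^ s) (q ℕ.^ k)) (sym (ℕₚ.^-distribˡ-+-* q k s))))))))))
        (ℤₚ.+-identityˡ _))
      bound : + (q ℕ.^ t ℕ.* q ℕ.^ t) ℤ.≤ + (q ℕ.^ s ℕ.* C ℕ.^ s ℕ.* (q ℕ.^ n ℕ.* q ℕ.^ n ℕ.* (q ℕ.^ k ℕ.* D ℕ.^ k)))
      bound = ≤ℤ
        where
        module ℤR = ℤₚ.≤-Reasoning
        ≤ℤ = ℤR.begin
          + (q ℕ.^ t ℕ.* q ℕ.^ t)
            ℤR.≡⟨ trans (ℤₚ.pos-* (q ℕ.^ t) (q ℕ.^ t)) (trans (negsquare (+ (q ℕ.^ t))) (cong (λ z → + 1 ℤ.* (z ℤ.* z)) (sym τf₀))) ⟩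
          + 1 ℤ.* (τ f₀ ℤ.* τ f₀)
            ℤR.≤⟨ total²≤ (column A d) d (λ i → ℕₚ.≤-trans 1≤ε (ε≤d i)) C d≤C injective is [] (tabulate-↑ʳ-⊆ k s (λ i → i)) z≤n f₀ [] ∑f₀ ⟩
          + (q ℕ.^ List.length is ℕ.* C ℕ.^ List.length is) ℤ.* norm² f₀
            ℤR.≡⟨ cong (λ m → + (q ℕ.^ m ℕ.* C ℕ.^ m) ℤ.* norm² f₀) length-is ⟩
          + (q ℕ.^ s ℕ.* C ℕ.^ s) ℤ.* norm² f₀
            ℤR.≤⟨ *-mono-≤-pos (q ℕ.^ s ℕ.* C ℕ.^ s) (ℤₚ.≤-trans norm²f₀≤ (subst (λ z → z ℤ.* norm² f ℤ.≤ z ℤ.* + (q ℕ.^ k ℕ.* D ℕ.^ k)) (ℤₚ.pos-* (q ℕ.^ n) (q ℕ.^ n)) (*-mono-≤-pos (q ℕ.^ n ℕ.* q ℕ.^ n) norm²f≤))) ⟩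
          + (q ℕ.^ s ℕ.* C ℕ.^ s) ℤ.* (N ℤ.* N ℤ.* + (q ℕ.^ k ℕ.* D ℕ.^ k))
            ℤR.≡⟨ cong (ℤ._*_ (+ (q ℕ.^ s ℕ.* C ℕ.^ s))) (trans (cong (ℤ._* + (q ℕ.^ k ℕ.* D ℕ.^ k)) (sym (ℤₚ.pos-* (q ℕ.^ n) (q ℕ.^ n)))) (sym (ℤₚ.pos-* (q ℕ.^ n ℕ.* q ℕ.^ n) (q ℕ.^ k ℕ.* D ℕ.^ k)))) ⟩
          + (q ℕ.^ s ℕ.* C ℕ.^ s) ℤ.* + (q ℕ.^ n ℕ.* q ℕ.^ n ℕ.* (q ℕ.^ k ℕ.* D ℕ.^ k))
            ℤR.≡⟨ ℤₚ.pos-* (q ℕ.^ s ℕ.* C ℕ.^ s) (q ℕ.^ n ℕ.* q ℕ.^ n ℕ.* (q ℕ.^ k ℕ.* D ℕ.^ k)) ⟨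
          + (q ℕ.^ s ℕ.* C ℕ.^ s ℕ.* (q ℕ.^ n ℕ.* q ℕ.^ n ℕ.* (q ℕ.^ k ℕ.* D ℕ.^ k))) ℤR.∎
          where
          negsquare : ∀ x → x ℤ.* x ≡ + 1 ℤ.* ((ℤ.- x) ℤ.* (ℤ.- x))
          negsquare = solve-∀

    -- A nonzero term of the sum provides the last `s` coordinates, and a point of the corresponding
    -- fibre of `h` the first `k`; the equation defining this fibre is the system with its terms
    -- rearranged.
    solution : ∃ λ (x : Fin t → K) → ∀ j → KSum.sum (λ i → A j i * x i ^ d i) ≡ G j (Vec.tabulate (λ l → x (l Fin.↑ˡ s)))
    solution =
      let xs , fu≢0 = total≢0 (column A d) d is f total-f≢0
          y , y-sum = powerSum-tabulate A d (k Fin.↑ʳ_) xs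
          x₀ , hx₀≢ = ∑-≢0 _ fu≢0
      in lookup x₀ VF.++ y , λ j → solves x₀ y j (trans (sym (Vecₚ.lookup∘tabulate _ j)) (trans (cong (λ v → lookup v j) (⟦⟧≢0 (h x₀ ≟ _) hx₀≢)) (y-sum j)))
      where
      ⟦⟧≢0 : ∀ {P : Set} (P? : Dec P) → ⟦ P? ⟧ ≢ + 0 → P
      ⟦⟧≢0 (yes p) _  = p
      ⟦⟧≢0 (no  _) ne = contradiction refl ne
      solves : ∀ x₀ y j →
        G j x₀ + - KSum.sum (λ l → A j (l Fin.↑ˡ s) * lookup x₀ l ^ d (l Fin.↑ˡ s)) ≡ KSum.sum (λ l → A j (k Fin.↑ʳ l) * y l ^ d (k Fin.↑ʳ l)) →
        KSum.sum (λ i → A j i * (lookup x₀ VF.++ y) i ^ d i) ≡ G j (Vec.tabulate (λ l → (lookup x₀ VF.++ y) (l Fin.↑ˡ s)))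
      solves x₀ y j e = begin
        KSum.sum (λ i → A j i * (lookup x₀ VF.++ y) i ^ d i)
          ≡⟨ sum-↑ k _ ⟩
        KSum.sum (λ l → A j (l Fin.↑ˡ s) * (lookup x₀ VF.++ y) (l Fin.↑ˡ s) ^ d (l Fin.↑ˡ s)) + KSum.sum (λ l → A j (k Fin.↑ʳ l) * (lookup x₀ VF.++ y) (k Fin.↑ʳ l) ^ d (k Fin.↑ʳ l))
          ≡⟨ cong₂ _+_ (KSum.sum-cong-≗ (λ l → cong (λ z → A j (l Fin.↑ˡ s) * z ^ d (l Fin.↑ˡ s)) (VFₚ.lookup-++ˡ (lookup x₀) y l)))
               (trans (KSum.sum-cong-≗ (λ l → cong (λ z → A j (k Fin.↑ʳ l) * z ^ d (k Fin.↑ʳ l)) (VFₚ.lookup-++ʳ (lookup x₀) y l))) (sym e)) ⟩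
        S + (G j x₀ + - S)
          ≡⟨ trans (+-comm S _) (trans (+-assoc (G j x₀) (- S) S) (trans (cong (_+_ (G j x₀)) (-‿inverseˡ S)) (+-identityʳ (G j x₀)))) ⟩
        G j x₀
          ≡⟨ cong (G j) (lookup-ext (λ l → trans (Vecₚ.lookup∘tabulate _ l) (VFₚ.lookup-++ˡ (lookup x₀) y l))) ⟨
        G j (Vec.tabulate (λ l → (lookup x₀ VF.++ y) (l Fin.↑ˡ s))) ∎
        where
        open ≡-Reasoning
        S = KSum.sum (λ l → A j (l Fin.↑ˡ s) * lookup x₀ l ^ d (l Fin.↑ˡ s))

-- Formal polynomials: coefficients and values

module PolynomialProperties {c ℓ₁ ℓ₂} (F : HeytingField c ℓ₁ ℓ₂) where
  open OverField F
  open CommutativeRing commutativeRing using (+-cong; +-congˡ; +-identityˡ; +-identityʳ; +-assoc; +-comm; distribʳ; zeroˡ; *-cong; *-congˡ; *-congʳ)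
    renaming (refl to ≈-refl; trans to ≈-trans; sym to ≈-sym; reflexive to ≈-reflexive)
  open SetoidReasoning setoid

  monomialAt : ∀ {k} → Vec ℕ k → Vector Carrier k → Carrier
  monomialAt e x = product (λ i → x i ^ Vec.lookup e i)

  restrict : ∀ {k p} {P : Pred (Vec ℕ k) p} → Decidable P → Polynomial k → Polynomial k
  restrict P? = List.filter (λ (_ , e) → P? e)

  module _ {k p} {P : Pred (Vec ℕ k) p} (P? : Decidable P) where

    coeff-restrict : ∀ g {e} → P e → coeff (restrict P? g) e ≈ coeff g e
    coeff-restrict []            Pe = ≈-refl
    coeff-restrict ((a , e′) ∷ g) {e} Pe with P? e′
    ... | yes _ with Vecₚ.≡-dec ℕₚ._≟_ e′ e
    ...   | yes _ = +-congˡ (coeff-restrict g Pe)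
    ...   | no  _ = coeff-restrict g Pe
    coeff-restrict ((a , e′) ∷ g) {e} Pe | no ¬Pe′ with Vecₚ.≡-dec ℕₚ._≟_ e′ e
    ...   | yes refl = contradiction Pe ¬Pe′
    ...   | no  _    = coeff-restrict g Pe

    coeff-restrict-¬ : ∀ g {e} → ¬ P e → coeff (restrict P? g) e ≈ 0#
    coeff-restrict-¬ []            ¬Pe = ≈-refl
    coeff-restrict-¬ ((a , e′) ∷ g) {e} ¬Pe with P? e′
    ... | no _ = coeff-restrict-¬ g ¬Pe
    ... | yes Pe′ with Vecₚ.≡-dec ℕₚ._≟_ e′ e
    ...   | yes refl = contradiction Pe′ ¬Pe
    ...   | no  _    = coeff-restrict-¬ g ¬Pe

    evaluate-restrict : ∀ g x → evaluate g x ≈ evaluate (restrict P? g) x + evaluate (restrict (λ e → ¬? (P? e)) g) x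
    evaluate-restrict []            x = ≈-sym (+-identityˡ 0#)
    evaluate-restrict ((a , e) ∷ g) x with P? e
    ... | yes _ = ≈-trans (+-congˡ (evaluate-restrict g x)) (≈-sym (+-assoc _ _ _))
    ... | no  _ = begin
      m + evaluate g x      ≈⟨ +-congˡ (evaluate-restrict g x) ⟩
      m + (u + v)           ≈⟨ +-assoc m u v ⟨
      m + u + v             ≈⟨ +-cong (+-comm m u) ≈-refl ⟩
      u + m + v             ≈⟨ +-assoc u m v ⟩
      u + (m + v)           ∎
      where
      m = a * monomialAt e x
      u = evaluate (restrict P? g) x
      v = evaluate (restrict (λ e → ¬? (P? e)) g) x

  evaluate-restrict-≡ : ∀ {k} (g : Polynomial k) e x →
    evaluate (restrict (λ e′ → Vecₚ.≡-dec ℕₚ._≟_ e′ e) g) x ≈ coeff g e * monomialAt e x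
  evaluate-restrict-≡ []             e x = ≈-sym (zeroˡ _)
  evaluate-restrict-≡ ((a , e′) ∷ g) e x with Vecₚ.≡-dec ℕₚ._≟_ e′ e
  ... | yes refl = ≈-trans (+-congˡ (evaluate-restrict-≡ g e x)) (≈-sym (distribʳ _ a (coeff g e)))
  ... | no  _    = evaluate-restrict-≡ g e x

  -- Terms may cancel without being zero, so they are grouped: all terms with the exponent of the
  -- first one add up to `coeff g e` times a monomial, and the others form a shorter list. Hence the
  -- induction on the length.
  evaluate-zero : ∀ {k} (g : Polynomial k) → (∀ e → coeff g e ≈ 0#) → ∀ x → evaluate g x ≈ 0#
  evaluate-zero g = go (List.length g) g ℕₚ.≤-refl
    where
    go : ∀ {k} m (g : Polynomial k) → List.length g ≤ m → (∀ e → coeff g e ≈ 0#) → ∀ x → evaluate g x ≈ 0#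
    go m       []             _         g≈0 x = ≈-refl
    go (suc m) g₀@((a , e) ∷ g) (s≤s g≤m) g≈0 x = begin
      evaluate g₀ x                                           ≈⟨ evaluate-restrict ≡e? g₀ x ⟩
      evaluate (restrict ≡e? g₀) x + evaluate others x        ≈⟨ +-cong (evaluate-restrict-≡ g₀ e x) (go m others shorter others≈0 x) ⟩
      coeff g₀ e * monomialAt e x + 0#                        ≈⟨ ≈-trans (+-identityʳ _) (≈-trans (*-congʳ (g≈0 e)) (zeroˡ _)) ⟩
      0#                                                      ∎
      where
      ≡e? : Decidable (_≡ e)
      ≡e? e′ = Vecₚ.≡-dec ℕₚ._≟_ e′ e
      others = restrict (λ e → ¬? (≡e? e)) g₀
      shorter : List.length others ≤ m
      shorter with ≡e? e
      ... | yes _ = ℕₚ.≤-trans (length-filter (λ (_ , e) → ¬? (≡e? e)) g) g≤m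
      ... | no ne = contradiction refl ne
      others≈0 : ∀ e′ → coeff others e′ ≈ 0#
      others≈0 e′ with ≡e? e′
      ... | yes refl = coeff-restrict-¬ (λ e → ¬? (≡e? e)) g₀ (λ ne → ne refl)
      ... | no ne    = ≈-trans (coeff-restrict (λ e → ¬? (≡e? e)) g₀ ne) (g≈0 e′)

  -- Terms of degree at least `ε` may occur in the list as long as they cancel. Dropping them leaves
  -- a representation of the kind that `DegreeBelow` asks for.
  evaluate-truncate : ∀ {k} ε (g : Polynomial k) → (∀ e → ε ≤ Vec.sum e → coeff g e ≈ 0#) → ∀ x →
    evaluate g x ≈ evaluate (restrict (λ e → Vec.sum e ℕₚ.<? ε) g) x
  evaluate-truncate ε g high≈0 x = ≈-trans (evaluate-restrict low? g x)
    (≈-trans (+-congˡ (evaluate-zero (restrict (λ e → ¬? (low? e)) g) rest≈0 x)) (+-identityʳ _))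
    where
    low? : Decidable (λ e → Vec.sum e < ε)
    low? e = Vec.sum e ℕₚ.<? ε
    rest≈0 : ∀ e → coeff (restrict (λ e → ¬? (low? e)) g) e ≈ 0#
    rest≈0 e with low? e
    ... | yes low = coeff-restrict-¬ (λ e → ¬? (low? e)) g (λ ¬low → ¬low low)
    ... | no ¬low = ≈-trans (coeff-restrict (λ e → ¬? (low? e)) g ¬low) (high≈0 e (ℕₚ.≮⇒≥ ¬low))

  sum-cong : ∀ {n} {f g : Vector Carrier n} → (∀ i → f i ≈ g i) → sum f ≈ sum g
  sum-cong {zero}  e = ≈-refl
  sum-cong {suc n} e = +-cong (e zero) (sum-cong (λ i → e (suc i)))

  product-cong : ∀ {n} {f g : Vector Carrier n} → (∀ i → f i ≈ g i) → product f ≈ product g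
  product-cong {zero}  e = ≈-refl
  product-cong {suc n} e = *-cong (e zero) (product-cong (λ i → e (suc i)))

  ^-cong : ∀ {x y} m → x ≈ y → x ^ m ≈ y ^ m
  ^-cong zero    e = ≈-refl
  ^-cong (suc m) e = *-cong e (^-cong m e)

  evaluate-cong : ∀ {k} (g : Polynomial k) {x y : Vector Carrier k} → (∀ l → x l ≈ y l) → evaluate g x ≈ evaluate g y
  evaluate-cong []            e = ≈-refl
  evaluate-cong ((a , e) ∷ g) x≈y = +-cong (*-congˡ (product-cong (λ i → ^-cong (lookup e i) (x≈y i)))) (evaluate-cong g x≈y)

  -- Brings the constant case into the form shared with the nonconstant one: vanishing of all
  -- coefficients of degree at least `ε`.
  constant-high : ∀ {k ε} {g : Polynomial k} → 1 ≤ ε → IsConstant g → ∀ e → ε ≤ Vec.sum e → coeff g e ≈ 0#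
  constant-high {k} {ε} {g} 1≤ε (a , g≈a) e ε≤e = ≈-trans (g≈a e) off
    where
    off : coeff (constant a) e ≈ 0#
    off with Vecₚ.≡-dec ℕₚ._≟_ (Vec.replicate k 0) e
    ... | yes refl = contradiction (subst (1 ≤_) (sum-replicate-0 k) (ℕₚ.≤-trans 1≤ε ε≤e)) λ ()
    ... | no  _    = ≈-refl

-- Transport of the field structure to `Fin q`

module Transport {c ℓ₁ ℓ₂} (F : HeytingField c ℓ₁ ℓ₂) {q : ℕ} (card : OverField.HasCardinality F q) where
  open OverField F
  open PolynomialProperties F
  open HeytingField F using (_#_; tight; #⇒invertible; -_; _-_)
  open CommutativeRing commutativeRing using (+-cong; +-congˡ; *-cong; +-identityʳ; rawRing; isCommutativeRing; *-congˡ; *-congʳ; ring)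
    renaming (refl to ≈-refl; trans to ≈-trans; sym to ≈-sym; reflexive to ≈-reflexive)
  open Inverse card using (to; from; to-cong; strictlyInverseˡ; strictlyInverseʳ)
  open import Algebra.Properties.Ring ring using (-0#≈0#)

  from-injective : ∀ {i j} → from i ≈ from j → i ≡ j
  from-injective {i} {j} e = trans (sym (strictlyInverseˡ i)) (trans (to-cong e) (strictlyInverseˡ j))

  _≈?_ : ∀ x y → Dec (x ≈ y)
  x ≈? y with to x Finₚ.≟ to y
  ... | yes e = yes (≈-trans (≈-sym (strictlyInverseʳ x)) (≈-trans (≈-reflexive (cong from e)) (strictlyInverseʳ y)))
  ... | no ne = no (λ e → ne (to-cong e))

  add mul : Op₂ (Fin q)
  add i j = to (from i + from j)
  mul i j = to (from i * from j)
  neg : Op₁ (Fin q)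
  neg i = to (- from i)
  zer one : Fin q
  zer = to 0#
  one = to 1#

  from-isRingMonomorphism : IsRingMonomorphism
    (record { Carrier = Fin q ; _≈_ = _≡_ ; _+_ = add ; _*_ = mul ; -_ = neg ; 0# = zer ; 1# = one }) rawRing from
  from-isRingMonomorphism = record
    { isRingHomomorphism = record
      { isSemiringHomomorphism = record
        { isNearSemiringHomomorphism = record
          { +-isMonoidHomomorphism = record
            { isMagmaHomomorphism = record
              { isRelHomomorphism = record { cong = λ e → ≈-reflexive (cong from e) }
              ; homo = λ i j → strictlyInverseʳ _
              }
            ; ε-homo = strictlyInverseʳ _
            }
          ; *-homo = λ i j → strictlyInverseʳ _
          }
        ; 1#-homo = strictlyInverseʳ _
        }
      ; -‿homo = λ i → strictlyInverseʳ _
      }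
    ; injective = from-injective
    }

  isCommutativeRing′ : IsCommutativeRing _≡_ add mul neg zer one
  isCommutativeRing′ = RingMonomorphism.isCommutativeRing from-isRingMonomorphism isCommutativeRing

  -- Apartness from 0 amounts to invertibility, which is decidable by search.
  inverse′ : ∀ x → x ≢ zer → ∃ λ y → mul y x ≡ one
  inverse′ x x≢0 with Finₚ.any? (λ y → mul y x Finₚ.≟ one)
  ... | yes p = p
  ... | no ¬p = contradiction (trans (sym (strictlyInverseˡ x)) (to-cong (proj₁ (tight (from x) 0#) ¬apart))) x≢0
    where
    ¬apart : ¬ (from x # 0#)
    ¬apart x#0 = let z , zx≈1 , _ = #⇒invertible x#0 in
      ¬p (to z , to-cong (≈-trans (*-cong (strictlyInverseʳ z) (≈-sym (≈-trans (+-congˡ -0#≈0#) (+-identityʳ (from x))))) zx≈1))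

  module _ (1<q : 1 < q) where
    module 𝕂 = FieldOnFin isCommutativeRing′ inverse′ 1<q
    open 𝕂 using (Independent; solution)

    from-+ : ∀ i j → from (add i j) ≈ from i + from j
    from-+ i j = strictlyInverseʳ _

    from-* : ∀ i j → from (mul i j) ≈ from i * from j
    from-* i j = strictlyInverseʳ _

    from-sum : ∀ {n} (f : Fin n → Fin q) → from (𝕂.KSum.sum f) ≈ sum (λ i → from (f i))
    from-sum {zero}  f = strictlyInverseʳ 0#
    from-sum {suc n} f = ≈-trans (from-+ _ _) (+-congˡ (from-sum (f ∘ suc)))

    from-product : ∀ {n} (f : Fin n → Fin q) → from (𝕂.product f) ≈ product (λ i → from (f i))
    from-product {zero}  f = strictlyInverseʳ 1#
    from-product {suc n} f = ≈-trans (from-* _ _) (*-congˡ (from-product (f ∘ suc)))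

    from-^ : ∀ x m → from (x 𝕂.^ m) ≈ from x ^ m
    from-^ x zero    = strictlyInverseʳ 1#
    from-^ x (suc m) = ≈-trans (from-* _ _) (*-congˡ (from-^ x m))

    from-evaluate : ∀ {k} (g : Polynomial k) x →
      from (𝕂.evaluateTerms (List.map (λ (a , e) → to a , e) g) x) ≈ evaluate g (λ l → from (lookup x l))
    from-evaluate []            x = strictlyInverseʳ 0#
    from-evaluate ((a , e) ∷ g) x = ≈-trans (from-+ _ _) (+-cong
      (≈-trans (from-* _ _) (*-cong (strictlyInverseʳ a) (≈-trans (from-product (λ i → lookup x i 𝕂.^ lookup e i)) (product-cong (λ i → from-^ (lookup x i) (lookup e i))))))
      (from-evaluate g x))

    degreeBelow : ∀ {k} ε (g : Polynomial k) → (∀ e → ε ≤ Vec.sum e → coeff g e ≈ 0#) →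
      𝕂.DegreeBelow ε (λ x → to (evaluate g (λ l → from (lookup x l))))
    degreeBelow ε g high≈0 =
      List.map (λ (a , e) → to a , e) (restrict low? g) ,
      map⁺ (all-filter (λ (_ , e) → low? e) g) ,
      λ x → from-injective (≈-trans (strictlyInverseʳ _) (≈-trans (evaluate-truncate ε g high≈0 _) (≈-sym (from-evaluate (restrict low? g) x))))
      where
      low? : Decidable (λ e → Vec.sum e < ε)
      low? e = Vec.sum e ℕₚ.<? ε

    module _ {n k s} (A : Matrix n (k ℕ.+ s)) (full : EveryMaximalSubmatrixHasFullRank A)
      (k≤n : k ≤ n) (2n≤t : 2 ℕ.* n ≤ k ℕ.+ s) (d : Fin (k ℕ.+ s) → ℕ) {ε D}
      (1≤ε : 1 ≤ ε) (ε≤d : ∀ i → ε ≤ d i) (d≤D : ∀ i → d i ≤ D)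
      (g : Vector (Polynomial k) n) (high≈0 : ∀ j e → ε ≤ Vec.sum e → coeff (g j) e ≈ 0#)
      (C : ℕ) (d≤C : ∀ i → 2 ℕ.+ 2 ℕ.* (suc (d i) ℕ.* d i) ≤ C)
      (large : C ℕ.^ s ℕ.* D ℕ.^ k < q ℕ.^ (k ℕ.+ s ∸ 2 ℕ.* n)) where

      A′ : Fin n → Fin (k ℕ.+ s) → Fin q
      A′ j i = to (A j i)

      -- Rank `n` gives `n` independent columns of each submatrix in an unspecified order, recorded
      -- by `π`; applying `from` carries a relation over `Fin q` to one over `F`.
      full′ : ∀ (σ : Fin n → Fin (k ℕ.+ s)) → Monotonic₁ Fin._<_ Fin._<_ σ →
        ∃ λ (π : Fin n → Fin n) → Independent (λ j l → A′ j (σ (π l)))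
      full′ σ mono = let (π , independent) , _ = full σ mono in π , λ y Ay≡0 l → from-injective
        (≈-trans (independent (from ∘ y) (λ j → ≈-trans
          (≈-sym (≈-trans (from-sum (λ l → mul (y l) (A′ j (σ (π l)))))
            (sum-cong (λ l → ≈-trans (from-* (y l) (A′ j (σ (π l)))) (*-congˡ (strictlyInverseʳ (A j (σ (π l)))))))))
          (≈-trans (≈-reflexive (cong from (Ay≡0 j))) (strictlyInverseʳ 0#))) l) (≈-sym (strictlyInverseʳ 0#)))

      solution-over-F : ∃ λ (x : Vector Carrier (k ℕ.+ s)) → ∀ j →
        sum (λ i → A j i * (x i ^ d i)) ≈ evaluate (g j) (λ l → x (l Fin.↑ˡ s))
      solution-over-F =
        let x , eq = solution A′ full′ k≤n 2n≤t d 1≤ε ε≤d d≤D (λ j x → to (evaluate (g j) (λ l → from (lookup x l))))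
                       (λ j → degreeBelow ε (g j) (high≈0 j)) C d≤C large
        in from ∘ x , λ j → ≈-trans
          (≈-sym (≈-trans (from-sum (λ i → mul (A′ j i) (x i 𝕂.^ d i)))
            (sum-cong (λ i → ≈-trans (from-* (A′ j i) (x i 𝕂.^ d i)) (*-cong (strictlyInverseʳ (A j i)) (from-^ (x i) (d i)))))))
          (≈-trans (≈-reflexive (cong from (eq j))) (≈-trans (strictlyInverseʳ _)
            (evaluate-cong (g j) (λ l → ≈-reflexive (cong from (Vecₚ.lookup∘tabulate (λ l → x (l Fin.↑ˡ s)) l))))))

-- Numerical estimates for the base 6 n d₁

module _ {n D : ℕ} (1≤n : 1 ≤ n) (1≤D : 1 ≤ D) where
  private
    B = 6 ℕ.* n ℕ.* D

    6D≤B : 6 ℕ.* D ≤ B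
    6D≤B = ℕₚ.*-monoˡ-≤ D (ℕₚ.*-monoʳ-≤ 6 1≤n)

    D≤B : D ≤ B
    D≤B = ℕₚ.≤-trans (ℕₚ.m≤n*m D 6) 6D≤B

    instance
      B≢0 : NonZero B
      B≢0 = ℕ.>-nonZero (ℕₚ.≤-trans 1≤D D≤B)

  -- Makes B² an admissible value of the constant `C` for all exponents at once.
  step-constant≤ : ∀ {d} → d ≤ D → 2 ℕ.+ 2 ℕ.* (suc d ℕ.* d) ≤ B ℕ.^ 2
  step-constant≤ {d} d≤D = begin
    2 ℕ.+ 2 ℕ.* (suc d ℕ.* d)      ≤⟨ ℕₚ.+-monoʳ-≤ 2 (ℕₚ.*-monoʳ-≤ 2 (ℕₚ.*-mono-≤ (s≤s d≤D) d≤D)) ⟩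
    2 ℕ.+ 2 ℕ.* (suc D ℕ.* D)      ≤⟨ square 1≤D ⟩
    6 ℕ.* D ℕ.* (6 ℕ.* D)          ≤⟨ ℕₚ.*-mono-≤ 6D≤B 6D≤B ⟩
    B ℕ.* B                        ≡⟨ cong (B ℕ.*_) (ℕₚ.*-identityʳ B) ⟨
    B ℕ.^ 2                        ∎
    where
    open ℕₚ.≤-Reasoning
    -- With `D = suc E` the difference of the two sides is a polynomial in `E` with nonnegative
    -- coefficients.
    expand : ∀ E → 2 ℕ.+ 2 ℕ.* (suc (suc E) ℕ.* suc E) ℕ.+ (34 ℕ.* (E ℕ.* E) ℕ.+ 66 ℕ.* E ℕ.+ 30) ≡ 6 ℕ.* suc E ℕ.* (6 ℕ.* suc E)
    expand = ℕSolver.solve-∀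
    square : ∀ {D} → 1 ≤ D → 2 ℕ.+ 2 ℕ.* (suc D ℕ.* D) ≤ 6 ℕ.* D ℕ.* (6 ℕ.* D)
    square {suc E} _ = subst (2 ℕ.+ 2 ℕ.* (suc (suc E) ℕ.* suc E) ≤_) (expand E) (ℕₚ.m≤m+n _ _)

  -- The `s` removed columns cost B² each and the `k` fibre variables at most B each; the exponent 2
  -- s + k stays below the 2 t + 2 granted by the hypothesis on `q`.
  total-constant≤ : ∀ k s → (B ℕ.^ 2) ℕ.^ s ℕ.* D ℕ.^ k ≤ B ℕ.^ (2 ℕ.* (k ℕ.+ s) ℕ.+ 2)
  total-constant≤ k s = begin
    (B ℕ.^ 2) ℕ.^ s ℕ.* D ℕ.^ k         ≤⟨ ℕₚ.*-mono-≤ (ℕₚ.≤-reflexive (ℕₚ.^-*-assoc B 2 s)) (ℕₚ.^-monoˡ-≤ k D≤B) ⟩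
    B ℕ.^ (2 ℕ.* s) ℕ.* B ℕ.^ k         ≡⟨ ℕₚ.^-distribˡ-+-* B (2 ℕ.* s) k ⟨
    B ℕ.^ (2 ℕ.* s ℕ.+ k)               ≤⟨ ℕₚ.^-monoʳ-≤ B (subst (2 ℕ.* s ℕ.+ k ≤_) (expand k s) (ℕₚ.m≤m+n _ _)) ⟩
    B ℕ.^ (2 ℕ.* (k ℕ.+ s) ℕ.+ 2)       ∎
    where
    open ℕₚ.≤-Reasoning
    expand : ∀ k s → 2 ℕ.* s ℕ.+ k ℕ.+ (k ℕ.+ 2) ≡ 2 ℕ.* (k ℕ.+ s) ℕ.+ 2
    expand = ℕSolver.solve-∀

  -- `B` is positive, so a power exceeding a power of `B` cannot have base at most 1.
  1<base : ∀ {q r m} → B ℕ.^ r < q ℕ.^ m → 1 < q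
  1<base {q} {r} {m} large = ℕₚ.≰⇒> (λ q≤1 → ℕₚ.<⇒≱ large (begin
    q ℕ.^ m      ≤⟨ ℕₚ.^-monoˡ-≤ m q≤1 ⟩
    1 ℕ.^ m      ≡⟨ ℕₚ.^-zeroˡ m ⟩
    1            ≤⟨ ℕₚ.m^n>0 B r ⟩
    B ℕ.^ r      ∎))
    where open ℕₚ.≤-Reasoning

-- Order of the exponents and conclusion

Antitonic-≤ : ∀ {t} {d : Fin t → ℕ} → Antitonic₁ Fin._<_ ℕ._<_ d → ∀ {i j} → i Fin.≤ j → d j ≤ d i
Antitonic-≤ {d = d} anti {i} {j} i≤j with i Finₚ.≟ j
... | yes refl = ℕₚ.≤-refl
... | no i≢j   = ℕₚ.<⇒≤ (anti (ℕₚ.≤∧≢⇒< i≤j (λ e → i≢j (Finₚ.toℕ-injective e))))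

firstIndex-≤ : ∀ {t} .⦃ _ : NonZero t ⦄ (i : Fin t) → firstIndex t Fin.≤ i
firstIndex-≤ {suc t} i = z≤n

≤-lastIndex : ∀ {t} .⦃ _ : NonZero t ⦄ (i : Fin t) → i Fin.≤ lastIndex t
≤-lastIndex {suc t} i = Finₚ.≤fromℕ i

module _ {c ℓ₁ ℓ₂} (F : HeytingField c ℓ₁ ℓ₂) where
  open OverField F
  open PolynomialProperties F using (evaluate-cong)
  open CommutativeRing commutativeRing using () renaming (trans to ≈-trans; reflexive to ≈-reflexive)

  -- The definition of degree bounds the exponents of coefficients that are not zero; decidable
  -- equality, available since the field is finite, turns this into vanishing of the high
  -- coefficients.
  high-coefficients≈0 : ∀ {q} → HasCardinality q → ∀ {n k ε} {g : Vector (Polynomial k) n} → 1 ≤ ε →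
    ConstantCase g ⊎ NonconstantCase g ε → ∀ j e → ε ≤ Vec.sum e → coeff (g j) e ≈ 0#
  high-coefficients≈0 card {g = g} 1≤ε (inj₁ const) j = PolynomialProperties.constant-high F {g = g j} 1≤ε (const j)
  high-coefficients≈0 card {g = g} 1≤ε (inj₂ (degrees , _)) j e ε≤e with Transport._≈?_ F card (coeff (g j) e) 0#
  ... | yes e≈0 = e≈0
  ... | no  e≉0 = let m , (_ , bound) , m<ε = degrees j in contradiction (ℕₚ.≤-trans ε≤e (bound e e≉0)) (ℕₚ.<⇒≱ m<ε)

  -- The equation `k + s ≡ t` is an argument so that matching it makes the split into `k` and `s`
  -- variables definitional.
  solvable : ∀ {q} → HasCardinality q → ∀ {t n k s} .{{_ : NonZero t}} → k ℕ.+ s ≡ t → 1 ≤ k → (k≤n : k ≤ n) →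
    (d : Fin t → ℕ) → Antitonic₁ Fin._<_ ℕ._<_ d → 2 ≤ d (lastIndex t) →
    (A : Matrix n t) → EveryMaximalSubmatrixHasFullRank A → (g : Vector (Polynomial k) n) → ConstantCase g ⊎ NonconstantCase g (d (lastIndex t)) →
    (2n≤t-1 : 2 ℕ.* n ≤ t ∸ 1) → ExceedsRationalPower q (6 ℕ.* n ℕ.* d (firstIndex t)) (2 ℕ.* t ℕ.+ 2) (t ∸ 2 ℕ.* n) →
    ∃ λ (x : Vector Carrier t) → ∀ (j : Fin n) →
      sum (λ i → A j i * (x i ^ d i)) ≈ evaluate (g j) (λ l → x (inject≤ l (k≤t {k} {n} {t} k≤n 2n≤t-1)))
  solvable {q} card {n = n} {k} {s} refl 1≤k k≤n d anti 2≤d A full g gCase 2n≤t-1 large =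
    -- The parameters are C = (6 n d₁)², D = d₁ and ε = d_t.
    let x , eq = Transport.solution-over-F F card (1<base 1≤n 1≤D {q} {2 ℕ.* (k ℕ.+ s) ℕ.+ 2} {k ℕ.+ s ∸ 2 ℕ.* n} large) A full k≤n (ℕₚ.≤-trans 2n≤t-1 (ℕₚ.m∸n≤m (k ℕ.+ s) 1))
                   d 1≤ε (λ i → Antitonic-≤ anti (≤-lastIndex i)) d≤D g (high-coefficients≈0 card {g = g} 1≤ε gCase)
                   ((6 ℕ.* n ℕ.* D) ℕ.^ 2) (λ i → step-constant≤ 1≤n 1≤D (d≤D i)) (ℕₚ.≤-<-trans (total-constant≤ 1≤n 1≤D k s) large)
    -- `inject≤ l` and `l ↑ˡ s` have the same underlying number.
    in x , λ j → ≈-trans (eq j) (evaluate-cong (g j) (λ l → ≈-reflexive (cong x (Finₚ.toℕ-injective (trans (Finₚ.toℕ-↑ˡ l s) (sym (Finₚ.toℕ-inject≤ l _)))))))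
    where
    D = d (firstIndex (k ℕ.+ s))
    1≤n = ℕₚ.≤-trans 1≤k k≤n
    1≤ε = ℕₚ.≤-trans (s≤s z≤n) 2≤d
    d≤D : ∀ i → d i ≤ D
    d≤D i = Antitonic-≤ anti (firstIndex-≤ i)
    1≤D = ℕₚ.≤-trans 1≤ε (d≤D (lastIndex (k ℕ.+ s)))

mainTheorem10 : ∀ {c ℓ₁ ℓ₂} (F : HeytingField c ℓ₁ ℓ₂) → let open OverField F in
    (q : ℕ) → HasCardinality q →
    (p : ℕ) → HasPositiveCharacteristic p →
    (t n k : ℕ) .{{_ : NonZero t}} →
    1 ≤ k → (k≤n : k ≤ n) →
    (d : Fin t → ℕ) →
    Antitonic₁ Fin._<_ ℕ._<_ d →
    2 ≤ d (lastIndex t) →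
    (∀ (i : Fin t) → p ∤ d i) →
    (A : Matrix n t) →
    EveryMaximalSubmatrixHasFullRank A →
    (g : Vector (Polynomial k) n) →
    ConstantCase g ⊎ NonconstantCase g (d (lastIndex t)) →
    (2n≤t-1 : 2 ℕ.* n ≤ t ∸ 1) →
    ExceedsRationalPower q (6 ℕ.* n ℕ.* d (firstIndex t)) (2 ℕ.* t ℕ.+ 2) (t ∸ 2 ℕ.* n) →
    ∃ λ (x : Vector Carrier t) → ∀ (j : Fin n) →
    sum (λ i → A j i * (x i ^ d i)) ≈
    evaluate (g j) (λ l → x (inject≤ l (k≤t {k} {n} {t} k≤n 2n≤t-1)))
mainTheorem10 F q card p _ t n k 1≤k k≤n d anti 2≤d p∤d A full g gCase 2n≤t-1 large =
  solvable F card (proj₂ (ℕₚ.m≤n⇒∃[o]m+o≡n (k≤t {k} {n} {t} k≤n 2n≤t-1))) 1≤k k≤n d anti 2≤d A full g gCase 2n≤t-1 large
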